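{- Let $\Gamma$ be a finite connected vertex-transitive cubic graph. Then there exist two vertices of $\Gamma$ whose pointwise stabiliser in $\mathrm{Aut}(\Gamma)$ is abelian.
   Context: Graphs are finite, simple and undirected; cubic means regular of valency $3$. -}

module Defs where

open import Algebra.Bundles using (Group)
open import Algebra.Definitions using (Commutative)
open import Data.Fin.Base using (Fin)
open import Data.Fin.Permutation
  using (Permutation′; _⟨$⟩ʳ_; _⟨$⟩ˡ_; inverseˡ; inverseʳ; _∘ₚ_; flip)
  renaming (id to idₚ; _≈_ to _≈ₚ_)
open import Data.Fin.Subset using (Subset; ∣_∣)
open import Data.Nat.Base using (ℕ)
open import Data.Product.Base using (_×_; _,_; Σ; ∃; proj₁; proj₂)
open import Data.Vec.Base using (tabulate)
open import Function.Bundles using (_⇔_; Equivalence; mk⇔)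
open import Level using (Level; 0ℓ; _⊔_)
open import Relation.Binary.Core using (Rel)
open import Relation.Binary.Definitions using (Decidable; Symmetric)
open import Relation.Binary.Construct.Closure.ReflexiveTransitive using (Star)
open import Relation.Binary.PropositionalEquality.Core
  using (_≡_; refl; sym; trans; cong; subst₂)
open import Relation.Nullary.Decidable.Core using (does)
open import Relation.Nullary.Negation.Core using (¬_)

record Graph (n : ℕ) : Set₁ where
  field
    Adj         : Rel (Fin n) 0ℓ
    adj?        : Decidable Adj
    symmetric   : Symmetric Adj
    irreflexive : ∀ {v} → ¬ Adj v v

module _ {n : ℕ} (Γ : Graph n) where
  open Graph Γ

  neighbours : Fin n → Subset n
  neighbours v = tabulate (λ w → does (adj? v w))

  valency : Fin n → ℕ
  valency v = ∣ neighbours v ∣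

  Cubic : Set
  Cubic = ∀ v → valency v ≡ 3

  -- The graph with no vertices is not connected; without the first component
  -- it would be connected, cubic and vertex-transitive.
  Connected : Set
  Connected = Fin n × (∀ u v → Star Adj u v)

  record Automorphism : Set where
    constructor automorphism
    field
      perm : Permutation′ n
      adj⇔ : ∀ u v → Adj u v ⇔ Adj (perm ⟨$⟩ʳ u) (perm ⟨$⟩ʳ v)

open Automorphism public

module _ {n : ℕ} {Γ : Graph n} where
  open Graph Γ

  infixl 8 _·_
  _·_ : Automorphism Γ → Fin n → Fin n
  g · v = perm g ⟨$⟩ʳ v

  infix 4 _≈ᴬ_
  _≈ᴬ_ : Rel (Automorphism Γ) 0ℓ
  g ≈ᴬ h = perm g ≈ₚ perm h

  -- _∘ₚ_ composes from left to right; here (g ∘ᴬ h) · v = g · (h · v).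
  infixr 9 _∘ᴬ_
  _∘ᴬ_ : Automorphism Γ → Automorphism Γ → Automorphism Γ
  g ∘ᴬ h = automorphism (perm h ∘ₚ perm g) λ u v → mk⇔
    (λ a → Equivalence.to (adj⇔ g _ _) (Equivalence.to (adj⇔ h u v) a))
    (λ a → Equivalence.from (adj⇔ h u v) (Equivalence.from (adj⇔ g _ _) a))

  idᴬ : Automorphism Γ
  idᴬ = automorphism idₚ λ _ _ → mk⇔ (λ a → a) (λ a → a)

  infix 10 _⁻¹ᴬ
  _⁻¹ᴬ : Automorphism Γ → Automorphism Γ
  g ⁻¹ᴬ = automorphism (flip (perm g)) λ u v → mk⇔
    (λ a → Equivalence.from (adj⇔ g _ _)
             (subst₂ Adj (sym (inverseʳ (perm g))) (sym (inverseʳ (perm g))) a))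
    (λ a → subst₂ Adj (inverseʳ (perm g)) (inverseʳ (perm g))
             (Equivalence.to (adj⇔ g _ _) a))

  ⁻¹ᴬ-cong : ∀ {g h : Automorphism Γ} → g ≈ᴬ h → (g ⁻¹ᴬ) ≈ᴬ (h ⁻¹ᴬ)
  ⁻¹ᴬ-cong {g} {h} g≈h v = trans
    (cong (perm g ⟨$⟩ˡ_)
      (sym (trans (g≈h (perm h ⟨$⟩ˡ v)) (inverseʳ (perm h)))))
    (inverseˡ (perm g))

Aut : ∀ {n} → Graph n → Group 0ℓ 0ℓ
Aut Γ = record
  { Carrier = Automorphism Γ
  ; _≈_     = _≈ᴬ_
  ; _∙_     = _∘ᴬ_
  ; ε       = idᴬ
  ; _⁻¹     = _⁻¹ᴬ
  ; isGroup = record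
    { isMonoid = record
      { isSemigroup = record
        { isMagma = record
          { isEquivalence = record
            { refl  = λ _ → refl
            ; sym   = λ p v → sym (p v)
            ; trans = λ p q v → trans (p v) (q v)
            }
          ; ∙-cong = λ {g} {g′} {h} {h′} p q v →
              trans (cong (g ·_) (q v)) (p (h′ · v))
          }
        ; assoc = λ _ _ _ _ → refl
        }
      ; identity = (λ _ _ → refl) , (λ _ _ → refl)
      }
    ; inverse = (λ g _ → inverseˡ (perm g)) , (λ g _ → inverseʳ (perm g))
    ; ⁻¹-cong = λ {g} {h} → ⁻¹ᴬ-cong {g = g} {h = h}
    }
  }

VertexTransitive : ∀ {n} → Graph n → Set
VertexTransitive Γ = ∀ u v → ∃ λ (g : Group.Carrier (Aut Γ)) → g · u ≡ v

PointwiseStabiliser : ∀ {n} (Γ : Graph n) → Fin n → Fin n → Group 0ℓ 0ℓ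
PointwiseStabiliser Γ v w = record
  { Carrier = Σ A.Carrier λ g → g · v ≡ v × g · w ≡ w
  ; _≈_     = λ g h → proj₁ g A.≈ proj₁ h
  ; _∙_     = λ (g , gv , gw) (h , hv , hw) →
                g A.∙ h , fix-∙ g h gv hv , fix-∙ g h gw hw
  ; ε       = A.ε , refl , refl
  ; _⁻¹     = λ (g , gv , gw) → g A.⁻¹ , fix-⁻¹ g gv , fix-⁻¹ g gw
  ; isGroup = record
    { isMonoid = record
      { isSemigroup = record
        { isMagma = record
          { isEquivalence = record
            { refl  = λ {g} → A.refl {proj₁ g}
            ; sym   = λ {g} {h} → A.sym {proj₁ g} {proj₁ h}
            ; trans = λ {g} {h} {k} → A.trans {proj₁ g} {proj₁ h} {proj₁ k}
            }
          ; ∙-cong = λ {g} {g′} {h} {h′} →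
              A.∙-cong {proj₁ g} {proj₁ g′} {proj₁ h} {proj₁ h′}
          }
        ; assoc = λ g h k → A.assoc (proj₁ g) (proj₁ h) (proj₁ k)
        }
      ; identity = (λ g → A.identityˡ (proj₁ g)) , (λ g → A.identityʳ (proj₁ g))
      }
    ; inverse = (λ g → A.inverseˡ (proj₁ g)) , (λ g → A.inverseʳ (proj₁ g))
    ; ⁻¹-cong = λ {g} {h} → A.⁻¹-cong {proj₁ g} {proj₁ h}
    }
  }
  where
  module A = Group (Aut Γ)

  fix-∙ : ∀ (g h : A.Carrier) {u} → g · u ≡ u → h · u ≡ u → (g A.∙ h) · u ≡ u
  fix-∙ g h gu hu = trans (cong (g ·_) hu) gu

  fix-⁻¹ : ∀ (g : A.Carrier) {u} → g · u ≡ u → (g A.⁻¹) · u ≡ u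
  fix-⁻¹ g gu =
    trans (cong (perm g ⟨$⟩ˡ_) (sym gu)) (inverseˡ (perm g))

IsAbelian : ∀ {c ℓ : Level} → Group c ℓ → Set (c ⊔ ℓ)
IsAbelian G = Commutative _≈_ _∙_
  where open Group G

{-# OPTIONS --safe #-}
module Submission where

-- Let G = Aut Γ.  If a vertex stabiliser moves all neighbours, G acts on the digraph of arcs
-- of Γ, (u , v) → (v , w) with w ≠ u; if it fixes exactly one neighbour mate v of v and moves
-- the others, G acts on the digraph of vertices with v → w for w ≠ v adjacent to mate v;
-- otherwise vertex stabilisers are trivial.  In both digraphs valencies are two.  Choose a
-- walk α 0, α 1, … with α (i+1) = a (α i), and let s be least such that the stabiliser of
-- α 0, …, α s is trivial.  Then stabilisers of shorter segments are generated by conjugates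
-- X i = aⁱ (X 0) a⁻ⁱ of a single element.  Unless stabilisers of single points are abelian,
-- let c be largest such that X 0 commutes with X 0, …, X c and put s = c + 1 + j.  Locating
-- [X 0 , X (c+1)] among the stabilisers of segments by a Hall–Witt type argument gives
-- 2j ≤ c + 1.  The stabiliser of a segment of length j is abelian, and it is the stabiliser
-- of its two ends: for arcs because Γ has no short non-backtracking closed walks, for
-- vertices because an element fixing only the ends would fail to commute with an element
-- central in the stabiliser of one of them.

open import Defs
open import Algebra.Bundles using (Group)
import Algebra.Properties.Group as GroupProperties
open import Data.Empty using (⊥-elim)
open import Data.Fin.Base using (Fin; zero; suc; toℕ; combine)
open import Data.Fin.Permutation using (permutation)
import Data.Fin.Permutation as Permutation
open import Data.Fin.Properties using (any?; all?; combine-injective; pigeonhole)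
import Data.Fin.Properties as Fin
open import Data.Fin.Subset using (Subset; ∣_∣; _∈_; inside; outside)
open import Data.List.Base using (_∷_; [])
open import Data.Nat.Base using (ℕ; zero; suc; _+_; _*_; _∸_; _≤_; _<_; z≤n; s≤s)
open import Data.Nat.Properties using
  ( _≤?_; ≤-refl; ≤-reflexive; ≤-trans; ≤-antisym; ≤-total; ≤-pred; <⇒≤; ≰⇒>; n≤1+n; n<1+n; m≤n+m
  ; m≤m+n; m≤n⇒m<n∨m≡n; m+[n∸m]≡n; m∸n+n≡m; m<n⇒0<n∸m; m≤n+o⇒m∸n≤o; +-suc; +-comm; +-identityʳ
  ; +-mono-≤; +-monoʳ-≤; +-monoˡ-≤; +-cancelʳ-≤; +-cancelˡ-<; suc-injective; 0≢1+n; allUpTo?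
  ; module ≤-Reasoning)
open import Data.Nat.Tactic.RingSolver using (solve)
open import Data.Product.Base using (_×_; _,_; proj₁; proj₂; ∃; ∃₂; swap; uncurry)
open import Data.Product.Properties using (×-≡,≡→≡)
open import Data.Sum.Base using (_⊎_; inj₁; inj₂)
open import Data.Unit.Base using (⊤; tt)
open import Data.Vec.Base as Vec using (Vec; lookup; tabulate; _[_]≔_; here; there)
open import Data.Vec.Properties using (lookup∘tabulate; lookup⇒[]=; []=⇒lookup; []≔-minimal)
open import Function.Base using (_∘_)
open import Function.Bundles using (Equivalence; mk⇔)
open import Level using (Level; 0ℓ; _⊔_)
open import Relation.Binary.Construct.Closure.ReflexiveTransitive using (Star; _◅_) renaming (ε to stop)
open import Relation.Binary.Definitions using (DecidableEquality)
open import Relation.Binary.PropositionalEquality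
  using (_≡_; _≢_; refl; sym; trans; cong; cong₂; subst; subst₂)
import Relation.Binary.Reasoning.Setoid as SetoidReasoning
open import Relation.Nullary using (¬_; Dec; yes; no; ¬?)
open import Relation.Nullary.Decidable using (map′; _×-dec_; _→-dec_; decidable-stable; dec-true)

-- The slack k turns a consequence of linear inequalities into a semiring identity.
≤-by : ∀ {a b l r} k → l ≤ r → a + r + k ≡ b + l → a ≤ b
≤-by {a} {b} {l} {r} k l≤r eq = +-cancelʳ-≤ r a b (begin
  a + r      ≤⟨ m≤m+n (a + r) k ⟩
  a + r + k  ≡⟨ eq ⟩
  b + l      ≤⟨ +-monoʳ-≤ b l≤r ⟩
  b + r      ∎)
  where open ≤-Reasoning

-- Commutation, conjugation and commutators in a group

module Commuting {c ℓ : Level} (G : Group c ℓ) where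
  open Group G renaming (refl to ≈-refl; sym to ≈-sym; trans to ≈-trans)
  open GroupProperties G
  open SetoidReasoning setoid

  infix 4 _#_
  _#_ : Carrier → Carrier → Set ℓ
  g # h = g ∙ h ≈ h ∙ g

  #-respʳ : ∀ {z g h} → g ≈ h → z # g → z # h
  #-respʳ g≈h z#g = ≈-trans (∙-congˡ (≈-sym g≈h)) (≈-trans z#g (∙-congʳ g≈h))

  #-ε : ∀ {z} → z # ε
  #-ε {z} = ≈-trans (identityʳ z) (≈-sym (identityˡ z))

  #-sym : ∀ {g h} → g # h → h # g
  #-sym = ≈-sym

  #-∙ : ∀ {z g h} → z # g → z # h → z # (g ∙ h)
  #-∙ {z} {g} {h} z#g z#h = begin
    z ∙ (g ∙ h)  ≈⟨ assoc z g h ⟨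
    z ∙ g ∙ h    ≈⟨ ∙-congʳ z#g ⟩
    g ∙ z ∙ h    ≈⟨ assoc g z h ⟩
    g ∙ (z ∙ h)  ≈⟨ ∙-congˡ z#h ⟩
    g ∙ (h ∙ z)  ≈⟨ assoc g h z ⟨
    g ∙ h ∙ z    ∎

  #-⁻¹ : ∀ {z g} → z # g → z # g ⁻¹
  #-⁻¹ {z} {g} z#g = begin
    z ∙ g ⁻¹               ≈⟨ \\-leftDividesʳ g (z ∙ g ⁻¹) ⟨
    g ⁻¹ ∙ (g ∙ (z ∙ g ⁻¹)) ≈⟨ ∙-congˡ (assoc g z (g ⁻¹)) ⟨
    g ⁻¹ ∙ (g ∙ z ∙ g ⁻¹)  ≈⟨ ∙-congˡ (∙-congʳ z#g) ⟨
    g ⁻¹ ∙ (z ∙ g ∙ g ⁻¹)  ≈⟨ ∙-congˡ (//-rightDividesʳ g z) ⟩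
    g ⁻¹ ∙ z               ∎

  -- The quotient g⁻¹ h comes from one step of sifting h through a generator g.
  #-unsift : ∀ {z g h} → z # g → z # (g ⁻¹ ∙ h) → z # h
  #-unsift {z} {g} {h} z#g z#g⁻¹h = #-respʳ (\\-leftDividesˡ g h) (#-∙ z#g z#g⁻¹h)

  #-sifted : ∀ {z g h} → z # h → z # (g ⁻¹ ∙ h) → z # g
  #-sifted {z} {g} {h} z#h z#g⁻¹h = #-respʳ eq (#-∙ z#h (#-⁻¹ z#g⁻¹h))
    where
    -- A generator g divided out of h is recovered here, so it commutes with whatever commutes with
    -- h and with the quotient. Contradictions with `far` arise in this way.
    eq : h ∙ (g ⁻¹ ∙ h) ⁻¹ ≈ g
    eq = begin
      h ∙ (g ⁻¹ ∙ h) ⁻¹  ≈⟨ ∙-congˡ (⁻¹-anti-homo-\\ g h) ⟩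
      h ∙ (h ⁻¹ ∙ g)     ≈⟨ \\-leftDividesˡ h g ⟩
      g                  ∎

  conj : Carrier → Carrier → Carrier
  conj g h = g ∙ h ∙ g ⁻¹

  conj-∙ : ∀ g h k → conj g h ∙ conj g k ≈ conj g (h ∙ k)
  conj-∙ g h k = begin
    g ∙ h ∙ g ⁻¹ ∙ (g ∙ k ∙ g ⁻¹)    ≈⟨ assoc (g ∙ h) (g ⁻¹) _ ⟩
    g ∙ h ∙ (g ⁻¹ ∙ (g ∙ k ∙ g ⁻¹))  ≈⟨ ∙-congˡ (∙-congˡ (assoc g k (g ⁻¹))) ⟩
    g ∙ h ∙ (g ⁻¹ ∙ (g ∙ (k ∙ g ⁻¹))) ≈⟨ ∙-congˡ (\\-leftDividesʳ g (k ∙ g ⁻¹)) ⟩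
    g ∙ h ∙ (k ∙ g ⁻¹)               ≈⟨ assoc (g ∙ h) k (g ⁻¹) ⟨
    g ∙ h ∙ k ∙ g ⁻¹                 ≈⟨ ∙-congʳ (assoc g h k) ⟩
    g ∙ (h ∙ k) ∙ g ⁻¹               ∎

  conj-cong : ∀ g {h k} → h ≈ k → conj g h ≈ conj g k
  conj-cong g h≈k = ∙-congʳ (∙-congˡ h≈k)

  conj-# : ∀ g {h k} → h # k → conj g h # conj g k
  conj-# g {h} {k} h#k =
    ≈-trans (conj-∙ g h k) (≈-trans (conj-cong g h#k) (≈-sym (conj-∙ g k h)))

  conj-conj⁻¹ : ∀ g h → conj g (conj (g ⁻¹) h) ≈ h
  conj-conj⁻¹ g h = begin
    g ∙ (g ⁻¹ ∙ h ∙ g ⁻¹ ⁻¹) ∙ g ⁻¹    ≈⟨ ∙-congʳ (∙-congˡ (∙-congˡ (⁻¹-involutive g))) ⟩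
    g ∙ (g ⁻¹ ∙ h ∙ g) ∙ g ⁻¹          ≈⟨ ∙-congʳ (∙-congˡ (assoc (g ⁻¹) h g)) ⟩
    g ∙ (g ⁻¹ ∙ (h ∙ g)) ∙ g ⁻¹        ≈⟨ ∙-congʳ (\\-leftDividesˡ g (h ∙ g)) ⟩
    h ∙ g ∙ g ⁻¹                       ≈⟨ //-rightDividesʳ g h ⟩
    h                                  ∎

  conj⁻¹-conj : ∀ g h → conj (g ⁻¹) (conj g h) ≈ h
  conj⁻¹-conj g h = ≈-trans
    (conj-cong (g ⁻¹) (∙-cong (∙-congʳ (≈-sym (⁻¹-involutive g))) (⁻¹-cong (≈-sym (⁻¹-involutive g)))))
    (conj-conj⁻¹ (g ⁻¹) h)

  conj-#⁻ : ∀ g {h k} → conj g h # conj g k → h # k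
  conj-#⁻ g {h} {k} c = #-respʳ (conj⁻¹-conj g k)
    (#-sym (#-respʳ (conj⁻¹-conj g h) (#-sym (conj-# (g ⁻¹) c))))

  ⁅_,_⁆ : Carrier → Carrier → Carrier
  ⁅ g , h ⁆ = conj g h ∙ h ⁻¹

  ⁅⁆≈ε⇒# : ∀ {g h} → ⁅ g , h ⁆ ≈ ε → g # h
  ⁅⁆≈ε⇒# {g} {h} eq = begin
    g ∙ h               ≈⟨ //-rightDividesˡ g (g ∙ h) ⟨
    g ∙ h ∙ g ⁻¹ ∙ g    ≈⟨ ∙-congʳ (x∙y⁻¹≈ε⇒x≈y (conj g h) h eq) ⟩
    h ∙ g               ∎

  -- A substitute for the Hall–Witt identity: u = x t x⁻¹ with t = [x⁻¹ , u] u,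
  -- and t commutes with y because both its factors do.
  #-conj : ∀ {u x y} → u # y → ⁅ x ⁻¹ , u ⁆ # y → u # conj x y
  #-conj {u} {x} {y} u#y v#y =
    #-sym (#-respʳ (conj-conj⁻¹ x u) (conj-# x (#-respʳ eq (#-∙ (#-sym v#y) (#-sym u#y)))))
    where
    eq : ⁅ x ⁻¹ , u ⁆ ∙ u ≈ conj (x ⁻¹) u
    eq = //-rightDividesˡ u (conj (x ⁻¹) u)

  #-⁅⁆ˡ : ∀ {u x y} → u # y → ⁅ x ⁻¹ , u ⁆ # y → u # ⁅ x , y ⁆
  #-⁅⁆ˡ u#y v#y = #-∙ (#-conj u#y v#y) (#-⁻¹ u#y)

  #-⁅⁆ʳ : ∀ {u x y} → u # x → ⁅ y ⁻¹ , u ⁆ # x → u # ⁅ x , y ⁆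
  #-⁅⁆ʳ {u} {x} {y} u#x v#x = #-respʳ eq (#-∙ u#x (#-conj (#-⁻¹ u#x) (#-⁻¹ v#x)))
    where
    -- The commutator is also x times the conjugate of x⁻¹ by y, which exchanges the roles of x and
    -- y.
    eq : x ∙ conj y (x ⁻¹) ≈ ⁅ x , y ⁆
    eq = begin
      x ∙ (y ∙ x ⁻¹ ∙ y ⁻¹)  ≈⟨ assoc x (y ∙ x ⁻¹) (y ⁻¹) ⟨
      x ∙ (y ∙ x ⁻¹) ∙ y ⁻¹  ≈⟨ ∙-congʳ (assoc x y (x ⁻¹)) ⟨
      x ∙ y ∙ x ⁻¹ ∙ y ⁻¹    ∎

-- Group actions and fixed points

record Action {c ℓ : Level} (G : Group c ℓ) (Ω : Set) : Set (c ⊔ ℓ) where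
  open Group G using (Carrier; _≈_; _∙_; ε; _⁻¹; inverseˡ; inverseʳ)
  infixr 6 _•_
  field
    _•_    : Carrier → Ω → Ω
    •-cong : ∀ {g h} → g ≈ h → ∀ x → g • x ≡ h • x
    ε-•    : ∀ x → ε • x ≡ x
    ∙-•    : ∀ g h x → (g ∙ h) • x ≡ g • h • x

  Preserves : (Ω → Ω → Set) → Set c
  Preserves R = ∀ g {x y} → R x y → R (g • x) (g • y)

  ⁻¹•• : ∀ g x → g ⁻¹ • g • x ≡ x
  ⁻¹•• g x = trans (sym (∙-• (g ⁻¹) g x)) (trans (•-cong (inverseˡ g) x) (ε-• x))

  •⁻¹• : ∀ g x → g • g ⁻¹ • x ≡ x
  •⁻¹• g x = trans (sym (∙-• g (g ⁻¹) x)) (trans (•-cong (inverseʳ g) x) (ε-• x))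

  •-injective : ∀ g {x y} → g • x ≡ g • y → x ≡ y
  •-injective g {x} {y} eq =
    trans (sym (⁻¹•• g x)) (trans (cong (g ⁻¹ •_) eq) (⁻¹•• g y))

  ∙-fix : ∀ {g h x} → g • x ≡ x → h • x ≡ x → (g ∙ h) • x ≡ x
  ∙-fix {g} {h} {x} gx hx = trans (∙-• g h x) (trans (cong (g •_) hx) gx)

  ⁻¹-fix : ∀ {g x} → g • x ≡ x → g ⁻¹ • x ≡ x
  ⁻¹-fix {g} {x} gx = trans (cong (g ⁻¹ •_) (sym gx)) (⁻¹•• g x)

  ⁻¹∙-fix : ∀ {g h x} → g • x ≡ h • x → (g ⁻¹ ∙ h) • x ≡ x
  ⁻¹∙-fix {g} {h} {x} eq =
    trans (∙-• (g ⁻¹) h x) (trans (cong (g ⁻¹ •_) (sym eq)) (⁻¹•• g x))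

  ∙-•-cong : ∀ {g h x y} → h • x ≡ y → (g ∙ h) • x ≡ g • y
  ∙-•-cong {g} {h} {x} hx = trans (∙-• g h x) (cong (g •_) hx)

  open Commuting G using (conj; ⁅_,_⁆)

  conj-• : ∀ g h x → conj g h • g • x ≡ g • h • x
  conj-• g h x = trans (∙-• (g ∙ h) (g ⁻¹) (g • x))
    (trans (cong ((g ∙ h) •_) (⁻¹•• g x)) (∙-• g h x))

  conj-fix : ∀ g {h x} → h • x ≡ x → conj g h • g • x ≡ g • x
  conj-fix g {h} {x} hx = trans (conj-• g h x) (cong (g •_) hx)

  conj-fix⁻ : ∀ g {h x} → conj g h • g • x ≡ g • x → h • x ≡ x
  conj-fix⁻ g {h} {x} eq = •-injective g (trans (sym (conj-• g h x)) eq)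

  conj⁻¹-fix : ∀ g {h x} → h • g • x ≡ g • x → conj (g ⁻¹) h • x ≡ x
  conj⁻¹-fix g {h} {x} hgx = subst (λ y → conj (g ⁻¹) h • y ≡ y) (⁻¹•• g x) (conj-fix (g ⁻¹) hgx)

  -- The first two factors to act carry x to z, so it suffices that g and h commute at the single
  -- point z.
  ⁅⁆-fix : ∀ {g h} x → (let y = h ⁻¹ • x in let z = g ⁻¹ • y in g • h • z ≡ h • g • z) →
           ⁅ g , h ⁆ • x ≡ x
  ⁅⁆-fix {g} {h} x eq =
    trans (∙-• (conj g h) (h ⁻¹) x)
    (trans (∙-• (g ∙ h) (g ⁻¹) _)
    (trans (∙-• g h _)
    (trans eq
    (trans (cong (h •_) (•⁻¹• g _)) (•⁻¹• h x)))))

  ⁅⁆-fix′ : ∀ {g h x} → g • x ≡ x → h • x ≡ x → ⁅ g , h ⁆ • x ≡ x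
  ⁅⁆-fix′ gx hx = ∙-fix (∙-fix (∙-fix gx hx) (⁻¹-fix gx)) (⁻¹-fix hx)

-- Stabilisers act on the at most two R-successors of a point through a group of order two.
module AtMostTwo
  {c ℓ : Level} {G : Group c ℓ} {Ω : Set} (action : Action G Ω)
  (_≟_ : DecidableEquality Ω) (R : Ω → Ω → Set) (R-• : Action.Preserves action R)
  (≤2 : ∀ {x y y₁ y₂} → R x y → R x y₁ → R x y₂ → y₁ ≢ y → y₂ ≢ y → y₁ ≡ y₂)
  where
  open Action action
  open Group G using (_⁻¹)
  open Commuting G using (⁅_,_⁆)

  R-fix : ∀ {g x y} → g • x ≡ x → R x y → R x (g • y)
  R-fix {g} gx r = subst (λ z → R z _) gx (R-• g r)

  agree : ∀ {g h x y} → g • x ≡ x → h • x ≡ x → R x y →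
          g • y ≢ y → h • y ≢ y → g • y ≡ h • y
  agree gx hx r = ≤2 r (R-fix gx r) (R-fix hx r)

  other-fixed : ∀ {g x y z} → g • x ≡ x → R x y → R x z → g • y ≡ y → g • z ≡ z
  other-fixed {g} {x} {y} {z} gx ry rz gy with z ≟ y
  ... | yes refl = gy
  ... | no z≢y = ≤2 ry (R-fix gx rz) rz (λ gz≡y → z≢y (•-injective g (trans gz≡y (sym gy)))) z≢y

  commute : ∀ {g h x y} → g • x ≡ x → h • x ≡ x → R x y → g • h • y ≡ h • g • y
  commute {g} {h} {x} {y} gx hx r with (g • y) ≟ y | (h • y) ≟ y
  ... | yes gy | _ = trans (other-fixed gx r (R-fix hx r) gy) (cong (h •_) (sym gy))
  ... | no _ | yes hy = trans (cong (g •_) hy) (sym (other-fixed hx r (R-fix gx r) hy))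
  ... | no gy | no hy = ≤2 (R-fix gx r) (R-fix gx (R-fix hx r)) (R-fix hx (R-fix gx r))
    (λ e → hy (•-injective g e))
    (λ e → gy (•-injective h (trans e (agree gx hx r gy hy))))

  -- A group of order two is abelian, so commutators act trivially on successors. This is what
  -- lengthens fixed segments.
  ⁅⁆-fix-successor : ∀ {g h x y} → g • x ≡ x → h • x ≡ x → R x y → ⁅ g , h ⁆ • y ≡ y
  ⁅⁆-fix-successor gx hx r =
    ⁅⁆-fix _ (commute gx hx (R-fix (⁻¹-fix gx) (R-fix (⁻¹-fix hx) r)))

-- Stabilisers of segments of a walk

module Segments {c ℓ : Level} {G : Group c ℓ} {Ω : Set} (action : Action G Ω) (α : ℕ → Ω) where
  open Action action
  open Group G
  open Commuting G

  -- Both bounds are included. Being a record, it lets g, p and q be inferred from a proof.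
  record Fix (g : Carrier) (p q : ℕ) : Set where
    constructor fixes
    field fixed : ∀ i → p ≤ i → i ≤ q → g • α i ≡ α i
  open Fix public

  Fix-⊆ : ∀ {g p q p′ q′} → Fix g p q → p ≤ p′ → q′ ≤ q → Fix g p′ q′
  Fix-⊆ f p≤p′ q′≤q .fixed i p′≤i i≤q′ = fixed f i (≤-trans p≤p′ p′≤i) (≤-trans i≤q′ q′≤q)

  Fix-point : ∀ {g p} → g • α p ≡ α p → Fix g p p
  Fix-point gp .fixed i p≤i i≤p with ≤-antisym p≤i i≤p
  ... | refl = gp

  Fix-suc : ∀ {g p q} → Fix g p q → g • α (suc q) ≡ α (suc q) → Fix g p (suc q)
  Fix-suc f e .fixed i p≤i i≤1+q with m≤n⇒m<n∨m≡n i≤1+q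
  ... | inj₁ (s≤s i≤q) = fixed f i p≤i i≤q
  ... | inj₂ refl = e

  Fix-pred : ∀ {g p q} → Fix g (suc p) q → g • α p ≡ α p → Fix g p q
  Fix-pred f e .fixed i p≤i i≤q with m≤n⇒m<n∨m≡n p≤i
  ... | inj₁ p<i = fixed f i p<i i≤q
  ... | inj₂ refl = e

  Fix-⁻¹ : ∀ {g p q} → Fix g p q → Fix (g ⁻¹) p q
  Fix-⁻¹ f .fixed i p≤i i≤q = ⁻¹-fix (fixed f i p≤i i≤q)

  Fix-∙ : ∀ {g h p q} → Fix g p q → Fix h p q → Fix (g ∙ h) p q
  Fix-∙ f f′ .fixed i p≤i i≤q = ∙-fix (fixed f i p≤i i≤q) (fixed f′ i p≤i i≤q)

  Fix-⁅⁆ : ∀ {g h p q} → Fix g p q → Fix h p q → Fix ⁅ g , h ⁆ p q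
  Fix-⁅⁆ f f′ .fixed i p≤i i≤q = ⁅⁆-fix′ (fixed f i p≤i i≤q) (fixed f′ i p≤i i≤q)

  -- X p generates the stabiliser of α (1+p), …, α (p+s), and the stabiliser of
  -- α (p+d), …, α (p+s) is generated by the d elements X p, …, X (p+d-1).
  record IsGenerating (s : ℕ) (X : ℕ → Carrier) : Set (c ⊔ ℓ) where
    field
      Fix-trivial : ∀ p {g} → Fix g p (p + s) → g ≈ ε
      X-fix       : ∀ p → Fix (X p) (suc p) (p + s)
      X-up        : ∀ p → X p • α (suc (p + s)) ≢ α (suc (p + s))
      X-down      : ∀ p → X p • α p ≢ α p

-- Sifting through the generators

module Generators {a ℓ : Level} {G : Group a ℓ} {Ω : Set} (action : Action G Ω)
  (_≟_ : DecidableEquality Ω) (E : Ω → Ω → Set) (E-• : Action.Preserves action E)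
  (out≤2 : ∀ {x y y₁ y₂} → E x y → E x y₁ → E x y₂ → y₁ ≢ y → y₂ ≢ y → y₁ ≡ y₂)
  (in≤2 : ∀ {x y y₁ y₂} → E y x → E y₁ x → E y₂ x → y₁ ≢ y → y₂ ≢ y → y₁ ≡ y₂)
  (α : ℕ → Ω) (α-E : ∀ i → E (α i) (α (suc i))) (s : ℕ) (X : ℕ → Group.Carrier G)
  (generating : Segments.IsGenerating action α s X)
  where
  open Group G using (Carrier; _≈_; _∙_; ε; _⁻¹)
  open Action action
  open Segments action α
  open IsGenerating generating
  open Commuting G

  private
    module Out = AtMostTwo action _≟_ E E-• out≤2
    module In = AtMostTwo action _≟_ (λ x y → E y x) (λ g → E-• g) in≤2

  -- If g moves α (p+s+1), it agrees there with X p, because α (p+s) has at most two successors;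
  -- dividing by X p then repairs g.
  sift-up : ∀ p {q g} → p < q → q ≤ p + s → Fix g q (p + s) →
            Fix g q (suc (p + s)) ⊎ Fix (X p ⁻¹ ∙ g) q (suc (p + s))
  sift-up p {q} {g} p<q q≤p+s f with (g • α (suc (p + s))) ≟ α (suc (p + s))
  ... | yes e = inj₁ (Fix-suc f e)
  ... | no g-up = inj₂ (Fix-suc (Fix-∙ (Fix-⁻¹ Xp-fix) f)
          (⁻¹∙-fix (Out.agree (fixed Xp-fix _ q≤p+s ≤-refl) (fixed f _ q≤p+s ≤-refl) (α-E _) (X-up p) g-up)))
    where
    Xp-fix : Fix (X p) q (p + s)
    Xp-fix = Fix-⊆ (X-fix p) p<q ≤-refl

  -- The mirror image, with the predecessors of α (p+1).
  sift-down : ∀ p {r g} → p < r → r ≤ p + s → Fix g (suc p) r →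
              Fix g p r ⊎ Fix (X p ⁻¹ ∙ g) p r
  sift-down p {r} {g} p<r r≤p+s f with (g • α p) ≟ α p
  ... | yes e = inj₁ (Fix-pred f e)
  ... | no g-down = inj₂ (Fix-pred (Fix-∙ (Fix-⁻¹ Xp-fix) f)
          (⁻¹∙-fix (In.agree (fixed Xp-fix _ ≤-refl p<r) (fixed f _ ≤-refl p<r) (α-E _) (X-down p) g-down)))
    where
    Xp-fix : Fix (X p) (suc p) r
    Xp-fix = Fix-⊆ (X-fix p) ≤-refl r≤p+s

  -- Sifting g through X p, ..., X (q-1) leaves an element that fixes α q, ..., α (q+s) and so is
  -- trivial. This expresses, in terms of centralisers, that these elements generate the stabiliser
  -- of the segment.
  centralise : ∀ p q r {z g} → p ≤ q → r ≡ p + s → q ≤ r →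
               (∀ i → p ≤ i → i < q → z # X i) → Fix g q r → z # g
  centralise p q r p≤q r≡p+s q≤r z#X f = go (q ∸ p) p (m+[n∸m]≡n p≤q) r≡p+s q≤r z#X f
    where
    go : ∀ d p {q r z g} → p + d ≡ q → r ≡ p + s → q ≤ r →
         (∀ i → p ≤ i → i < q → z # X i) → Fix g q r → z # g
    go zero p refl refl _ _ f =
      #-respʳ (Group.sym G (Fix-trivial p (Fix-⊆ f (≤-reflexive (+-identityʳ p)) ≤-refl))) #-ε
    go (suc d) p {q} {z = z} refl refl q≤r z#X f = decide (sift-up p p<q q≤r f)
      where
      p<q : p < p + suc d
      p<q = subst (p <_) (sym (+-suc p d)) (s≤s (m≤m+n p d))
      next : ∀ {g} → Fix g (p + suc d) (suc (p + s)) → z # g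
      next = go d (suc p) (sym (+-suc p d)) refl (≤-trans q≤r (n≤1+n _)) (λ i p<i → z#X i (<⇒≤ p<i))
      decide : ∀ {g} → Fix g (p + suc d) (suc (p + s)) ⊎ Fix (X p ⁻¹ ∙ g) (p + suc d) (suc (p + s)) → z # g
      decide (inj₁ f′) = next f′
      decide (inj₂ f′) = #-unsift (z#X p ≤-refl p<q) (next f′)

  Fix-⁅⁆-extend : ∀ {g h} p q → p < q → Fix g (suc p) q → Fix h (suc p) q → Fix ⁅ g , h ⁆ p (suc q)
  Fix-⁅⁆-extend p q p<q f f′ = Fix-pred
    (Fix-suc (Fix-⁅⁆ f f′)
      (Out.⁅⁆-fix-successor (fixed f _ p<q ≤-refl) (fixed f′ _ p<q ≤-refl) (α-E _)))
    (In.⁅⁆-fix-successor (fixed f _ ≤-refl p<q) (fixed f′ _ ≤-refl p<q) (α-E _))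

  -- Commutators of generators at distance c + 1

  module Commutation (c j : ℕ) (s≡ : s ≡ suc c + j) (0<j : 0 < j)
    (near : ∀ i k → i ≤ k + c → k ≤ i + c → X i # X k)
    (far : ∀ i k → k ≡ i + suc c → ¬ X i # X k)
    where

    private
      s≤ : s ≤ suc c + j
      s≤ = ≤-reflexive s≡
      s≥ : suc c + j ≤ s
      s≥ = ≤-reflexive (sym s≡)
      -- The hypothesis given to `≤-by` when the inequality follows from no other one.
      0≤0 : 0 ≤ 0
      0≤0 = z≤n
      infixr 5 _⊕_
      _⊕_ : ∀ {a b a′ b′} → a ≤ b → a′ ≤ b′ → a + a′ ≤ b + b′
      _⊕_ = +-mono-≤

    w : ℕ → Carrier
    w e = ⁅ X e , X (e + suc c) ⁆

    w≉ε : ∀ e → ¬ w e ≈ ε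
    w≉ε e w≈ε = far e (e + suc c) refl (⁅⁆≈ε⇒# w≈ε)

    -- Both generators fix α (e+c+2), ..., α (e+s), and their commutator gains a point at each end.
    w-fix : ∀ e → Fix (w e) (e + suc c) (suc (e + s))
    w-fix e = Fix-⁅⁆-extend (e + suc c) (e + s)
      (≤-by 0 (s≥ ⊕ 0<j) (solve (e ∷ c ∷ s ∷ j ∷ [])))
      (Fix-⊆ (X-fix e) (≤-by (suc c) 0≤0 (solve (e ∷ c ∷ []))) ≤-refl)
      (Fix-⊆ (X-fix (e + suc c)) ≤-refl (≤-by (suc c) 0≤0 (solve (e ∷ c ∷ s ∷ []))))

    -- For k = c the fixed segment would have s + 1 points, making w e trivial.
    w-fix⇒<c : ∀ e k → k ≤ c → Fix (w e) (e + suc c) (suc (k + e + s)) → k < c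
    w-fix⇒<c e k k≤c f with m≤n⇒m<n∨m≡n k≤c
    ... | inj₁ k<c = k<c
    ... | inj₂ refl = ⊥-elim (w≉ε e (Fix-trivial (e + suc c)
            (Fix-⊆ f ≤-refl (≤-by 0 0≤0 (solve (e ∷ c ∷ s ∷ []))))))

    -- Otherwise X (k+1+e) would occur in w e.  All other generators that can occur commute with
    -- u = X (k+1+e+c+1), and so does w e by the Hall–Witt argument.
    w-fix-up : ∀ e k → k < j → Fix (w e) (e + suc c) (suc (k + e + s)) × k < c
    w-fix-up e zero _ = w-fix e , w-fix⇒<c e 0 z≤n (w-fix e)
    w-fix-up e (suc k) 1+k<j with w-fix-up e k (<⇒≤ 1+k<j)
    ... | f , k<c with sift-up (suc k + e) {e + suc c} (≤-by 0 k<c (solve (k ∷ e ∷ c ∷ [])))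
            (≤-by (suc (k + j)) s≥ (solve (k ∷ e ∷ c ∷ s ∷ j ∷ []))) f
    ... | inj₁ f′ = f′ , w-fix⇒<c e (suc k) k<c f′
    ... | inj₂ f′ = ⊥-elim (far (suc k + e) (suc k + e + suc c) refl (#-sym (#-sifted u#w u#w′)))
      where
      u : Carrier
      u = X (suc k + e + suc c)
      v : Carrier
      v = ⁅ X e ⁻¹ , u ⁆
      v-fix : Fix v (suc k + e + suc c) (suc (e + s))
      v-fix = Fix-⁅⁆-extend (suc k + e + suc c) (e + s)
        (≤-by 0 (s≥ ⊕ 1+k<j) (solve (k ∷ e ∷ c ∷ s ∷ j ∷ [])))
        (Fix-⁻¹ (Fix-⊆ (X-fix e) (≤-by (suc k + suc c) 0≤0 (solve (k ∷ e ∷ c ∷ []))) ≤-refl))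
        (Fix-⊆ (X-fix (suc k + e + suc c)) ≤-refl
          (≤-by (suc k + suc c) 0≤0 (solve (k ∷ e ∷ c ∷ s ∷ []))))
      -- v lies in the group of X (e+1), ..., X (k+e+c+1), all within distance c of X (e+c+1)
      -- because k < c.
      Xb#v : X (e + suc c) # v
      Xb#v = centralise (suc e) (suc k + e + suc c) (suc (e + s))
        (≤-by (k + suc c) 0≤0 (solve (k ∷ e ∷ c ∷ []))) refl
        (≤-by 2 (s≥ ⊕ 1+k<j) (solve (k ∷ e ∷ c ∷ s ∷ j ∷ [])))
        (λ i e<i i<u → near (e + suc c) i
          (≤-by 0 e<i (solve (e ∷ i ∷ c ∷ [])))
          (≤-by 1 (i<u ⊕ k<c) (solve (i ∷ k ∷ e ∷ c ∷ []))))
        v-fix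
      u#Xb : u # X (e + suc c)
      u#Xb = near (suc k + e + suc c) (e + suc c) (≤-by 0 k<c (solve (k ∷ e ∷ c ∷ [])))
        (≤-by (suc k + c) 0≤0 (solve (k ∷ e ∷ c ∷ [])))
      u#w : u # w e
      u#w = #-⁅⁆ˡ u#Xb (#-sym Xb#v)
      u#w′ : u # (X (suc k + e) ⁻¹ ∙ w e)
      u#w′ = centralise (suc (suc k + e)) (e + suc c) (suc (suc k + e + s))
        (≤-by 0 k<c (solve (k ∷ e ∷ c ∷ []))) refl
        (≤-by (2 + k + j) s≥ (solve (k ∷ e ∷ c ∷ s ∷ j ∷ [])))
        (λ i p<i i<b → near (suc k + e + suc c) i
          (≤-by 0 p<i (solve (i ∷ k ∷ e ∷ c ∷ [])))
          (≤-by (suc (suc (k + c))) i<b (solve (i ∷ k ∷ e ∷ c ∷ []))))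
        f′

    -- The mirror image of `w-fix-up`: X (m+c+1) cannot occur in w e, because u = X m commutes with
    -- w e and with the other generators that can occur, but not with X (m+c+1).
    w-fix-down : ∀ e k m → k < j → m + k ≡ e → Fix (w e) (m + suc c) (suc (e + s))
    w-fix-down e zero m _ m+0≡e =
      Fix-⊆ (w-fix e) (≤-by 0 (≤-reflexive (sym m+0≡e)) (solve (e ∷ c ∷ m ∷ []))) ≤-refl
    w-fix-down e (suc k) m 1+k<j m+1+k≡e = decide (sift-down (m + suc c) {suc (e + s)}
        (≤-by (suc (k + j)) (e≥ ⊕ s≥) (solve (m ∷ k ∷ e ∷ c ∷ s ∷ j ∷ [])))
        (≤-by 0 (e≤ ⊕ k<c) (solve (m ∷ k ∷ e ∷ c ∷ s ∷ [])))
        (w-fix-down e k (suc m) (<⇒≤ 1+k<j) (trans (sym (+-suc m k)) m+1+k≡e)))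
      where
      e≤ : e ≤ m + suc k
      e≤ = ≤-reflexive (sym m+1+k≡e)
      e≥ : m + suc k ≤ e
      e≥ = ≤-reflexive m+1+k≡e
      k<c : k < c
      k<c = proj₂ (w-fix-up e k (<⇒≤ 1+k<j))
      u : Carrier
      u = X m
      v : Carrier
      v = ⁅ X (e + suc c) ⁻¹ , u ⁆
      v-fix : Fix v (e + suc c) (suc (m + s))
      v-fix = Fix-⁅⁆-extend (e + suc c) (m + s)
        (≤-by 0 (e≤ ⊕ 1+k<j ⊕ s≥) (solve (m ∷ k ∷ e ∷ c ∷ s ∷ j ∷ [])))
        (Fix-⁻¹ (Fix-⊆ (X-fix (e + suc c)) ≤-refl
          (≤-by (c + k + 2) e≥ (solve (m ∷ k ∷ e ∷ c ∷ s ∷ [])))))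
        (Fix-⊆ (X-fix m) (≤-by (c + k + 2) e≥ (solve (m ∷ k ∷ e ∷ c ∷ []))) ≤-refl)
      Xe#v : X e # v
      Xe#v = centralise (suc m) (e + suc c) (suc (m + s))
        (≤-by (c + k + 1) e≥ (solve (m ∷ k ∷ e ∷ c ∷ []))) refl
        (≤-by 2 (e≤ ⊕ 1+k<j ⊕ s≥) (solve (m ∷ k ∷ e ∷ c ∷ s ∷ j ∷ [])))
        (λ i m<i i<b → near e i
          (≤-by 1 (m<i ⊕ e≤ ⊕ k<c) (solve (i ∷ m ∷ k ∷ e ∷ c ∷ [])))
          (≤-by 0 i<b (solve (i ∷ e ∷ c ∷ []))))
        v-fix
      u#Xe : u # X e
      u#Xe = near m e (≤-by (c + k + 1) e≥ (solve (m ∷ k ∷ e ∷ c ∷ [])))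
        (≤-by 0 (e≤ ⊕ k<c) (solve (m ∷ k ∷ e ∷ c ∷ [])))
      u#w : u # w e
      u#w = #-⁅⁆ʳ u#Xe (#-sym Xe#v)
      u#w′ : Fix (X (m + suc c) ⁻¹ ∙ w e) (m + suc c) (suc (e + s)) → u # (X (m + suc c) ⁻¹ ∙ w e)
      u#w′ = centralise (suc e) (m + suc c) (suc (e + s))
        (≤-by 0 (e≤ ⊕ k<c) (solve (m ∷ k ∷ e ∷ c ∷ []))) refl
        (≤-by (2 + k + j) (e≥ ⊕ s≥) (solve (m ∷ k ∷ e ∷ c ∷ s ∷ j ∷ [])))
        (λ i e<i i<p → near m i
          (≤-by (c + k + 2) (e≥ ⊕ e<i) (solve (i ∷ m ∷ k ∷ e ∷ c ∷ [])))
          (≤-by 0 i<p (solve (i ∷ m ∷ c ∷ []))))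
      decide : Fix (w e) (m + suc c) (suc (e + s)) ⊎ Fix (X (m + suc c) ⁻¹ ∙ w e) (m + suc c) (suc (e + s)) →
               Fix (w e) (m + suc c) (suc (e + s))
      decide (inj₁ f) = f
      decide (inj₂ f) = ⊥-elim (far m (m + suc c) refl (#-sifted u#w (u#w′ f)))

    private
      j⁻ : ℕ
      j⁻ = j ∸ 1
      j≡ : j ≡ suc j⁻
      j≡ = sym (m+[n∸m]≡n 0<j)

    j≤c : j ≤ c
    j≤c = subst (_≤ c) (sym j≡) (proj₂ (w-fix-up 0 j⁻ (≤-reflexive (sym j≡))))

    -- For e = j - 1, extending both ways as far as possible shows that w e fixes α (c+1), ..., α
    -- (2j-1+s). If 2j > c + 1, this includes s + 1 consecutive points and w e is trivial.
    2j≤1+c : j + j ≤ suc c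
    2j≤1+c = bound j⁻ j≡
      where
      bound : ∀ i → j ≡ suc i → j + j ≤ suc c
      bound i j≡ with j + j ≤? suc c
      ... | yes le = le
      ... | no ≰ = ⊥-elim (w≉ε i (Fix-trivial (suc c) fix))
        where
        i<j : i < j
        i<j = ≤-reflexive (sym j≡)
        j≤ : j ≤ suc i
        j≤ = ≤-reflexive j≡
        fix : Fix (w i) (suc c) (suc c + s)
        fix .fixed t c<t t≤ with t ≤? suc (i + s)
        ... | yes t≤′ = fixed (w-fix-down i i 0 i<j refl) t c<t t≤′
        ... | no t≰ = fixed (proj₁ (w-fix-up i i i<j)) t
          (≤-by (j + 2) (≰⇒> t≰ ⊕ s≥) (solve (i ∷ c ∷ s ∷ j ∷ t ∷ [])))
          (≤-by 0 (t≤ ⊕ ≰⇒> ≰ ⊕ j≤ ⊕ j≤) (solve (i ∷ c ∷ s ∷ j ∷ t ∷ [])))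

    -- The stabiliser of the segment is generated by X j, ..., X (s-1), whose indices differ by at
    -- most s - 1 - j = c.
    Fix-commute : ∀ {g h} → Fix g s (s + j) → Fix h s (s + j) → g # h
    Fix-commute {g} {h} f f′ = #-sym (generated (λ i j≤i i<s → #-sym (generated (X# i j≤i i<s) f′)) f)
      where
      generated : ∀ {z g} → (∀ i → j ≤ i → i < s → z # X i) → Fix g s (s + j) → z # g
      generated = centralise j s (s + j) (≤-by (suc c) s≥ (solve (c ∷ s ∷ j ∷ [])))
        (+-comm s j) (m≤m+n s j)
      X# : ∀ i → j ≤ i → i < s → ∀ k → j ≤ k → k < s → X i # X k
      X# i j≤i i<s k j≤k k<s = near i k
        (≤-by 0 (i<s ⊕ s≤ ⊕ j≤k) (solve (i ∷ k ∷ c ∷ s ∷ j ∷ [])))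
        (≤-by 0 (k<s ⊕ s≤ ⊕ j≤i) (solve (i ∷ k ∷ c ∷ s ∷ j ∷ [])))

    -- For s + k with k < j, the element X (k + j) is central in the stabiliser of α s
    -- but does not commute with X (s + k).
    Fix-between : ∀ {g} → g • α s ≡ α s → g • α (s + j) ≡ α (s + j) → Fix g s (s + j)
    Fix-between {g} gs gsj = go j ≤-refl (Fix-point gsj)
      where
      go : ∀ k → k ≤ j → Fix g (s + k) (s + j) → Fix g s (s + j)
      go zero _ f = Fix-⊆ f (≤-by 0 0≤0 (solve (s ∷ []))) ≤-refl
      go (suc k) k<j f with sift-down (s + k) {suc (s + k)} ≤-refl
          (≤-by (c + j) s≥ (solve (c ∷ s ∷ j ∷ k ∷ [])))
          (Fix-⊆ f (≤-by 0 0≤0 (solve (s ∷ k ∷ []))) (≤-by 0 k<j (solve (s ∷ k ∷ j ∷ []))))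
      ... | inj₁ f′ = go k (<⇒≤ k<j)
            (Fix-pred (Fix-⊆ f (≤-by 0 0≤0 (solve (s ∷ k ∷ []))) ≤-refl) (fixed f′ _ ≤-refl (n≤1+n _)))
      ... | inj₂ f′ = ⊥-elim (far (k + j) (s + k)
            (trans (cong (_+ k) s≡) (solve (c ∷ j ∷ k ∷ []))) (#-sifted u#g u#g′))
        where
        -- Here 2j ≤ c + 1 enters: k + j ≤ 2j - 1 ≤ c, so X (k+j) is within distance c of each of X
        -- 0, ..., X (s-1).
        u#g : X (k + j) # g
        u#g = centralise 0 s s z≤n refl ≤-refl
          (λ i _ i<s → near (k + j) i
            (≤-by i (k<j ⊕ 2j≤1+c) (solve (i ∷ k ∷ c ∷ j ∷ [])))
            (≤-by k (i<s ⊕ s≤) (solve (i ∷ k ∷ c ∷ s ∷ j ∷ []))))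
          (Fix-point gs)
        u#g′ : X (k + j) # (X (s + k) ⁻¹ ∙ g)
        u#g′ = centralise (suc k) (s + k) (suc (s + k))
          (≤-by (c + j) s≥ (solve (c ∷ s ∷ j ∷ k ∷ []))) (cong suc (+-comm s k)) (n≤1+n _)
          (λ i k<i i<p → near (k + j) i
            (≤-by 1 (k<i ⊕ j≤c) (solve (i ∷ k ∷ c ∷ j ∷ [])))
            (≤-by 0 (i<p ⊕ s≤) (solve (i ∷ k ∷ c ∷ s ∷ j ∷ []))))
          f′

    -- X 0 fixes α s; if the ends agreed, it would fix the whole segment, including α (s+1).
    αs≢αs+j : α s ≢ α (s + j)
    αs≢αs+j eq = X-up 0 (fixed (Fix-between X₀s (subst (λ x → X 0 • x ≡ x) eq X₀s)) (suc s) (n≤1+n s)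
        (≤-by 0 0<j (solve (s ∷ j ∷ []))))
      where
      X₀s : X 0 • α s ≡ α s
      X₀s = fixed (X-fix 0) s (≤-by (c + j) s≥ (solve (c ∷ s ∷ j ∷ []))) ≤-refl

-- Least failures and periodic orbits

least-failure : ∀ {ℓ} (P : ℕ → Set ℓ) → (∀ i → Dec (P i)) → ∀ n →
  (∀ i → i < n → P i) ⊎ (∃ λ k → k < n × ¬ P k × (∀ i → i < k → P i))
least-failure P P? zero = inj₁ λ _ ()
least-failure P P? (suc n) with least-failure P P? n
... | inj₂ (k , k<n , rest) = inj₂ (k , ≤-trans k<n (n≤1+n n) , rest)
... | inj₁ all with P? n
... | no ¬Pn = inj₂ (n , ≤-refl , ¬Pn , all)
... | yes Pn = inj₁ λ i i<1+n → extend i (m≤n⇒m<n∨m≡n i<1+n)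
  where
  extend : ∀ i → suc i < suc n ⊎ suc i ≡ suc n → P i
  extend i (inj₁ (s≤s i<n)) = all i i<n
  extend i (inj₂ refl) = Pn

module Orbits {c ℓ : Level} {G : Group c ℓ} {Ω : Set} (action : Action G Ω)
  {size : ℕ} (code : Ω → Fin size) (code-injective : ∀ {x y} → code x ≡ code y → x ≡ y) where
  open Action action

  orbit : Group.Carrier G → Ω → ℕ → Ω
  orbit g x zero = x
  orbit g x (suc i) = g • orbit g x i

  orbit-cancel : ∀ g x i d → orbit g x i ≡ orbit g x (i + d) → x ≡ orbit g x d
  orbit-cancel g x zero d eq = eq
  orbit-cancel g x (suc i) d eq = orbit-cancel g x i d (•-injective g eq)

  -- Pigeonhole gives a repetition, which is cancelled back to the start. The form `suc N` records
  -- that the period is positive.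
  periodic : ∀ g x → ∃ λ N → orbit g x (suc N) ≡ x
  periodic g x with pigeonhole (n<1+n size) (code ∘ orbit g x ∘ toℕ)
  ... | i , k , i<k , eq = toℕ k ∸ suc (toℕ i) , sym (orbit-cancel g x (toℕ i) _
    (trans (code-injective eq) (cong (orbit g x)
      (sym (trans (+-suc (toℕ i) _) (m+[n∸m]≡n i<k))))))

-- Vertex-transitive digraphs with valencies at most two

record IsTransitiveDigraph {G : Group 0ℓ 0ℓ} {Ω : Set} (action : Action G Ω)
                           (V : Ω → Set) (E : Ω → Ω → Set) : Set₁ where
  open Group G using (Carrier; _≈_; ε)
  open Action action
  field
    size           : ℕ
    code           : Ω → Fin size
    code-injective : ∀ {x y} → code x ≡ code y → x ≡ y
    source         : ∀ {x y} → E x y → V x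
    target         : ∀ {x y} → E x y → V y
    E-•            : Preserves E
    out≤2          : ∀ {x y y₁ y₂} → E x y → E x y₁ → E x y₂ → y₁ ≢ y → y₂ ≢ y → y₁ ≡ y₂
    in≤2           : ∀ {x y y₁ y₂} → E y x → E y₁ x → E y₂ x → y₁ ≢ y → y₂ ≢ y → y₁ ≡ y₂
    transitive     : ∀ {x y} → V x → V y → ∃ λ g → g • x ≡ y
    -- P stands for any nonempty union of connected components of the digraph; the connectedness of
    -- Γ enters when this is proved for the two digraphs.
    faithful       : ∀ g (P : Ω → Set) → (∀ {x y} → E x y → P x → P y) →
                     (∀ {x y} → E x y → P y → P x) → (∀ {x} → P x → g • x ≡ x) →
                     ∀ {x} → V x → P x → g ≈ ε
    _≈?_           : ∀ g h → Dec (g ≈ h)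
    ∃?             : ∀ (P : Carrier → Set) → (∀ {g h} → g ≈ h → P g → P h) →
                     (∀ g → Dec (P g)) → Dec (∃ P)

module Digraph {G : Group 0ℓ 0ℓ} {Ω : Set} {action : Action G Ω} {V : Ω → Set} {E : Ω → Ω → Set}
  (digraph : IsTransitiveDigraph action V E) {x₀ x₁ : Ω} (x₀→x₁ : E x₀ x₁)
  where
  open Group G renaming (refl to ≈-refl; sym to ≈-sym; trans to ≈-trans)
  open Action action
  open IsTransitiveDigraph digraph
  open Commuting G
  open Orbits action code code-injective

  _≟_ : DecidableEquality Ω
  x ≟ y = map′ code-injective (cong code) (code x Fin.≟ code y)

  private
    module Out = AtMostTwo action _≟_ E E-• out≤2

    a : Carrier
    a = proj₁ (transitive (source x₀→x₁) (target x₀→x₁))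

  α : ℕ → Ω
  α = orbit a x₀

  open Segments action α

  α-E : ∀ i → E (α i) (α (suc i))
  α-E zero = subst (E x₀) (sym (proj₂ (transitive (source x₀→x₁) (target x₀→x₁)))) x₀→x₁
  α-E (suc i) = E-• a (α-E i)

  private
    -- If g x = y, the arc x → y starts the directed cycle x, g x, g² x, ..., so forward steps lead
    -- from y back to x.
    backward : (P : Ω → Set) → (∀ {x y} → E x y → P x → P y) → ∀ {x y} → E x y → P y → P x
    backward P forward {x} {y} x→y Py with transitive (source x→y) (target x→y)
    ... | g , gx≡y with periodic g x
    ... | N , eq = subst P eq (along N)
      where
      step : ∀ i → E (orbit g x i) (orbit g x (suc i))
      step zero = subst (E x) (sym gx≡y) x→y
      step (suc i) = E-• g (step i)
      along : ∀ i → P (orbit g x (suc i))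
      along zero = subst P (sym gx≡y) Py
      along (suc i) = forward (step (suc i)) (along i)

  Moves : ℕ → Set
  Moves k = ∃ λ g → Fix g 0 k × g • α (suc k) ≢ α (suc k)

  private
    Moves? : ∀ k → Dec (Moves k)
    Moves? k = ∃? _
      (λ g≈h → λ (f , m) → fixes (λ i p q → trans (•-cong (≈-sym g≈h) (α i)) (fixed f i p q))
                         , λ e → m (trans (•-cong g≈h _) e))
      (λ g → Fix? g ×-dec ¬? ((g • α (suc k)) ≟ α (suc k)))
      where
      Fix? : ∀ g → Dec (Fix g 0 k)
      Fix? g = map′ (λ f → fixes λ i _ i≤k → f (s≤s i≤k))
        (λ f → λ { {i} (s≤s i≤k) → fixed f i z≤n i≤k })
        (allUpTo? (λ i → (g • α i) ≟ α i) (suc k))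

  abstract
    -- The search ends because α is periodic: what fixes α 0 also fixes α (N+1) = α 0. That the
    -- stabiliser of α 0, ..., α s is trivial, and not only moves no next point, is shown in
    -- `Fix-trivial₀`.
    rank : ∃ λ s → ¬ Moves s × (∀ k → k < s → Moves k)
    rank with periodic a x₀
    ... | N , eq with least-failure Moves Moves? (suc N)
    ... | inj₂ (s , _ , ¬Ms , Mk) = s , ¬Ms , Mk
    ... | inj₁ all with all N ≤-refl
    ... | g , f , m = ⊥-elim (m (subst (λ x → g • x ≡ x) (sym eq) (fixed f 0 z≤n z≤n)))

  s : ℕ
  s = proj₁ rank

  moves : ∀ k → k < s → Moves k
  moves = proj₂ (proj₂ rank)

  -- F is imposed on every vertex: it is taken to be "fixed by g" for faithfulness and trivial for
  -- plain walks.
  data Walk (F : Ω → Set) : ℕ → Ω → Ω → Set where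
    start : ∀ {x} → F x → Walk F 0 x x
    step  : ∀ {k x y z} → Walk F k x y → E y z → F z → Walk F (suc k) x z

  -- If g carries α 0, …, α k correctly but not α (k+1), composing it with an element that
  -- fixes α 0, …, α k and moves α (k+1) repairs it.
  walk-transitive : ∀ {F k x y} → k ≤ s → V x → Walk F k x y →
    ∃ λ g → g • α 0 ≡ x × g • α k ≡ y × (∀ i → i ≤ k → F (g • α i))
  walk-transitive {F} _ Vx (start Fx) with transitive (source x₀→x₁) Vx
  ... | g , gx₀≡x = g , gx₀≡x , gx₀≡x , λ { zero _ → subst F (sym gx₀≡x) Fx }
  walk-transitive {F} {suc k} {x} {z} k<s Vx (step {y = y} wk y→z Fz)
    with walk-transitive (<⇒≤ k<s) Vx wk
  ... | g , g0 , gk , Fg with (g • α (suc k)) ≟ z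
  ... | yes eq = g , g0 , eq , extend
    where
    extend : ∀ i → i ≤ suc k → F (g • α i)
    extend i i≤ with m≤n⇒m<n∨m≡n i≤
    ... | inj₁ (s≤s i≤k) = Fg i i≤k
    ... | inj₂ refl = subst F (sym eq) Fz
  ... | no neq with moves k k<s
  ... | h , h-fix , h-moves = g ∙ h , trans (agrees 0 z≤n) g0 , eq , extend
    where
    agrees : ∀ i → i ≤ k → (g ∙ h) • α i ≡ g • α i
    agrees i i≤k = ∙-•-cong (fixed h-fix i z≤n i≤k)
    y→gα : E y (g • α (suc k))
    y→gα = subst (λ t → E t (g • α (suc k))) gk (E-• g (α-E k))
    y→ghα : E y (g • h • α (suc k))
    y→ghα = subst (λ t → E t (g • h • α (suc k))) gk
      (E-• g (subst (λ t → E t (h • α (suc k))) (fixed h-fix k z≤n ≤-refl) (E-• h (α-E k))))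
    eq : (g ∙ h) • α (suc k) ≡ z
    eq = trans (∙-• g h _)
      (out≤2 y→gα y→ghα y→z (h-moves ∘ •-injective g) (neq ∘ sym))
    extend : ∀ i → i ≤ suc k → F ((g ∙ h) • α i)
    extend i i≤ with m≤n⇒m<n∨m≡n i≤
    ... | inj₁ (s≤s i≤k) = subst F (sym (agrees i i≤k)) (Fg i i≤k)
    ... | inj₂ refl = subst F (sym eq) Fz

  private
    drop-first : ∀ {F k x y} → Walk F (suc k) x y → ∃ λ x′ → V x′ × Walk F k x′ y
    drop-first (step (start _) x→y Fy) = _ , target x→y , start Fy
    drop-first (step wk@(step _ _ _) y→z Fz) with drop-first wk
    ... | x′ , Vx′ , wk′ = x′ , Vx′ , step wk′ y→z Fz

    last-satisfies : ∀ {F k x y} → Walk F k x y → F y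
    last-satisfies (start Fx) = Fx
    last-satisfies (step _ _ Fz) = Fz

    -- P, the set of ends of s-step walks fixed by g, is closed under successors: some translate of
    -- α 0, ..., α s by an h is fixed by g and ends at y; since the stabiliser of α 0, ..., α s
    -- moves no next point, g fixes h (α (s+1)), and with it every successor of y.
    Fix-trivial₀ : ∀ {g} → Fix g 0 s → g ≈ ε
    Fix-trivial₀ {g} f = faithful g P forward (backward P forward)
      (λ (_ , _ , wk) → last-satisfies wk) (target (α-E s))
      (forward (α-E s) (_ , source x₀→x₁ , segment s ≤-refl))
      where
      F : Ω → Set
      F x = g • x ≡ x
      P : Ω → Set
      P y = ∃ λ x → V x × Walk F s x y
      forward : ∀ {y z} → E y z → P y → P z
      forward {y} {z} y→z (x , Vx , wk) with walk-transitive ≤-refl Vx wk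
      ... | h , h0 , hs , Fh = drop-first (step wk y→z
              (Out.other-fixed (last-satisfies wk) y→hα y→z g-fixes-hα))
        where
        y→hα : E y (h • α (suc s))
        y→hα = subst (λ t → E t (h • α (suc s))) hs (E-• h (α-E s))
        g′ : Carrier
        g′ = conj (h ⁻¹) g
        g′-fixes : g′ • α (suc s) ≡ α (suc s)
        g′-fixes = decidable-stable ((g′ • α (suc s)) ≟ α (suc s)) λ m →
          proj₁ (proj₂ rank) (g′ , fixes (λ i _ i≤s → conj⁻¹-fix h (Fh i i≤s)) , m)
        g-fixes-hα : g • h • α (suc s) ≡ h • α (suc s)
        g-fixes-hα = trans (•-cong (≈-sym (conj-conj⁻¹ h g)) _) (conj-fix h g′-fixes)
      segment : ∀ k → k ≤ s → Walk F k (α 0) (α k)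
      segment zero _ = start (fixed f 0 z≤n z≤n)
      segment (suc k) k<s = step (segment k (<⇒≤ k<s)) (α-E k) (fixed f (suc k) z≤n k<s)

    Fix-trivial : ∀ p {g} → Fix g p (p + s) → g ≈ ε
    Fix-trivial zero f = Fix-trivial₀ f
    Fix-trivial (suc p) {g} f = begin
      g                      ≈⟨ conj-conj⁻¹ a g ⟨
      conj a (conj (a ⁻¹) g) ≈⟨ conj-cong a (Fix-trivial p
                                  (fixes λ i p≤i i≤ → conj⁻¹-fix a (fixed f (suc i) (s≤s p≤i) (s≤s i≤)))) ⟩
      conj a ε               ≈⟨ ∙-congʳ (identityʳ a) ⟩
      a ∙ a ⁻¹               ≈⟨ inverseʳ a ⟩
      ε                      ∎
      where open SetoidReasoning setoid

  AbelianStabiliser : Set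
  AbelianStabiliser = ∃ λ x → V x × (∀ g h → g • x ≡ x → h • x ≡ x → g # h)

  -- The bound on j excludes short closed walks in the case of arcs; the distinct ends and the last
  -- component serve in the case of vertices.
  AbelianSegment : Set
  AbelianSegment = ∃ λ j → 0 < j × suc (j + j) ≤ s × α s ≢ α (s + j) ×
    (∀ g h → Fix g s (s + j) → Fix h s (s + j) → g # h) ×
    (∀ g → g • α s ≡ α s → g • α (s + j) ≡ α (s + j) → Fix g s (s + j))

  private
    α-V : ∀ i → V (α i)
    α-V i = source (α-E i)

    module Nontrivial (s′ : ℕ) (s≡ : s ≡ suc s′) where
      x̂ : Moves s′
      x̂ = moves s′ (≤-reflexive (sym s≡))

      -- The witness x̂ fixes α 0, ..., α (s-1) and moves α s. X 0 is already conjugated once by a,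
      -- so that the points fixed by X p start at α (p+1).
      X : ℕ → Carrier
      X zero = conj a (proj₁ x̂)
      X (suc p) = conj a (X p)

      Fix-conj : ∀ {g p q} → Fix g p q → Fix (conj a g) (suc p) (suc q)
      Fix-conj f .fixed (suc i) (s≤s p≤i) (s≤s i≤q) = conj-fix a (fixed f i p≤i i≤q)

      X-fix : ∀ p → Fix (X p) (suc p) (p + s)
      X-fix zero = subst (Fix (X 0) 1) (sym s≡) (Fix-conj (proj₁ (proj₂ x̂)))
      X-fix (suc p) = Fix-conj (X-fix p)

      X-up : ∀ p → X p • α (suc (p + s)) ≢ α (suc (p + s))
      X-up zero eq = proj₂ (proj₂ x̂) (conj-fix⁻ a (subst (λ t → X 0 • α (suc t) ≡ α (suc t)) s≡ eq))
      X-up (suc p) eq = X-up p (conj-fix⁻ a eq)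

      -- Otherwise X p would fix s + 1 consecutive points and be trivial, against `X-up`.
      X-down : ∀ p → X p • α p ≢ α p
      X-down p eq = X-up p (trans (•-cong (Fix-trivial p (Fix-pred (X-fix p) eq)) _) (ε-• _))

      generating : IsGenerating s X
      generating = record { Fix-trivial = Fix-trivial ; X-fix = X-fix ; X-up = X-up ; X-down = X-down }

      open Generators action _≟_ E E-• out≤2 in≤2 α α-E s X generating

      -- Conjugation by a raises both indices, so whether two generators commute depends only on
      -- their distance.
      shift : ∀ d i → X 0 # X d → X i # X (i + d)
      shift d zero c = c
      shift d (suc i) c = conj-# a (shift d i c)

      unshift : ∀ d i → X i # X (i + d) → X 0 # X d
      unshift d zero c = c
      unshift d (suc i) c = unshift d i (conj-#⁻ a c)

      near≤ : ∀ n → (∀ d → d < n → X 0 # X d) → ∀ {i k} → i ≤ k → k < i + n → X i # X k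
      near≤ n X₀# {i} {k} i≤k k<i+n = subst (λ t → X i # X t) (m+[n∸m]≡n i≤k)
        (shift (k ∸ i) i (X₀# _ (+-cancelˡ-< i _ _ (subst (_< i + n) (sym (m+[n∸m]≡n i≤k)) k<i+n))))

      near : ∀ n → (∀ d → d < n → X 0 # X d) → ∀ i k → i < k + n → k < i + n → X i # X k
      near n X₀# i k i<k+n k<i+n with ≤-total i k
      ... | inj₁ i≤k = near≤ n X₀# i≤k k<i+n
      ... | inj₂ k≤i = #-sym (near≤ n X₀# k≤i i<k+n)

      dichotomy : AbelianStabiliser ⊎ AbelianSegment
      dichotomy with least-failure (λ d → X 0 # X d) (λ d → (X 0 ∙ X d) ≈? (X d ∙ X 0)) s
      ... | inj₁ X₀# = inj₁ (α s , α-V s , λ g h gs hs →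
              #-sym (generated (λ i i<s → #-sym (generated (X# i i<s) hs)) gs))
        where
        generated : ∀ {z g} → (∀ i → i < s → z # X i) → g • α s ≡ α s → z # g
        generated z#X gs = centralise 0 s s z≤n refl ≤-refl (λ i _ → z#X i) (Fix-point gs)
        X# : ∀ i → i < s → ∀ k → k < s → X i # X k
        X# i i<s k k<s = near s X₀# i k (≤-trans i<s (m≤n+m s k)) (≤-trans k<s (m≤n+m s i))
      ... | inj₂ (zero , _ , ¬# , _) = ⊥-elim (¬# ≈-refl)
      ... | inj₂ (suc c , c<s , ¬# , X₀#) = inj₂ (j , 0<j , 2j<s , αs≢αs+j ,
              (λ _ _ → Fix-commute) , (λ _ → Fix-between))
        where
        j : ℕ
        j = s ∸ suc c
        s≡1+c+j : s ≡ suc c + j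
        s≡1+c+j = sym (m+[n∸m]≡n (<⇒≤ c<s))
        0<j : 0 < j
        0<j = m<n⇒0<n∸m c<s
        near-c : ∀ i k → i ≤ k + c → k ≤ i + c → X i # X k
        near-c i k i≤ k≤ = near (suc c) X₀# i k
          (subst (i <_) (sym (+-suc k c)) (s≤s i≤)) (subst (k <_) (sym (+-suc i c)) (s≤s k≤))
        far-c : ∀ i k → k ≡ i + suc c → ¬ X i # X k
        far-c i k refl i#k = ¬# (unshift _ i i#k)
        open Commutation c j s≡1+c+j 0<j near-c far-c
        2j<s : suc (j + j) ≤ s
        2j<s = subst (suc (j + j) ≤_) (sym s≡1+c+j) (s≤s (+-monoˡ-≤ j j≤c))

  abelian-stabiliser-or-segment : AbelianStabiliser ⊎ AbelianSegment
  abelian-stabiliser-or-segment = by-rank s refl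
    where
    by-rank : ∀ n → s ≡ n → AbelianStabiliser ⊎ AbelianSegment
    by-rank (suc s′) s≡ = Nontrivial.dichotomy s′ s≡
    by-rank zero s≡0 = inj₁ (α 0 , α-V 0 , λ g h g0 h0 →
      #-sym (#-respʳ (≈-sym (trivial g0)) #-ε))
      where
      trivial : ∀ {g} → g • α 0 ≡ α 0 → g ≈ ε
      trivial g0 = Fix-trivial₀ (subst (Fix _ 0) (sym s≡0) (Fix-point g0))

-- Finite subsets and finite search

∣remove∣ : ∀ {n} {p : Subset n} {x} → x ∈ p → ∣ p ∣ ≡ suc ∣ p [ x ]≔ outside ∣
∣remove∣ here = refl
∣remove∣ (there {y = inside} x∈p) = cong suc (∣remove∣ x∈p)
∣remove∣ (there {y = outside} x∈p) = ∣remove∣ x∈p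

∣∣≡suc⇒nonempty : ∀ {n} (p : Subset n) {k} → ∣ p ∣ ≡ suc k → ∃ (_∈ p)
∣∣≡suc⇒nonempty (inside Vec.∷ p) _ = zero , here
∣∣≡suc⇒nonempty (outside Vec.∷ p) eq with ∣∣≡suc⇒nonempty p eq
... | x , x∈p = suc x , there x∈p

∈-remove⁻ : ∀ {n} (p : Subset n) x {y} → y ∈ p [ x ]≔ outside → y ∈ p × y ≢ x
∈-remove⁻ (s Vec.∷ p) zero (there y∈p) = there y∈p , λ ()
∈-remove⁻ (s Vec.∷ p) (suc x) here = here , λ ()
∈-remove⁻ (s Vec.∷ p) (suc x) (there y∈) with ∈-remove⁻ p x y∈
... | y∈p , y≢x = there y∈p , y≢x ∘ Fin.suc-injective

any-vec? : ∀ {m n} (P : Vec (Fin m) n → Set) → (∀ v → Dec (P v)) → Dec (∃ P)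
any-vec? {n = zero} P P? = map′ (Vec.[] ,_) (λ { (Vec.[] , p) → p }) (P? Vec.[])
any-vec? {n = suc n} P P? =
  map′ (λ (x , v , p) → x Vec.∷ v , p) (λ { (x Vec.∷ v , p) → x , v , p })
    (any? λ x → any-vec? (P ∘ (x Vec.∷_)) (P? ∘ (x Vec.∷_)))

-- Automorphisms and neighbours in a graph

module _ {n : ℕ} (Γ : Graph n) where
  open Graph Γ
  open Group (Aut Γ) using (Carrier; _≈_; _∙_; _⁻¹)

  private
    Valid : Vec (Fin n) n → Vec (Fin n) n → Set
    Valid f f′ = (∀ i → lookup f (lookup f′ i) ≡ i) × (∀ i → lookup f′ (lookup f i) ≡ i) ×
      (∀ u v → Adj u v → Adj (lookup f u) (lookup f v)) ×
      (∀ u v → Adj (lookup f u) (lookup f v) → Adj u v)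

    Valid? : ∀ f f′ → Dec (Valid f f′)
    Valid? f f′ = all? (λ i → _ Fin.≟ _) ×-dec all? (λ i → _ Fin.≟ _) ×-dec
      all? (λ u → all? λ v → adj? u v →-dec adj? _ _) ×-dec
      all? (λ u → all? λ v → adj? _ _ →-dec adj? u v)

    fromTables : ∀ f f′ → Valid f f′ → Automorphism Γ
    fromTables f f′ (l , r , to , from) =
      automorphism (permutation (lookup f) (lookup f′) l r) λ u v → mk⇔ (to u v) (from u v)

    table : Automorphism Γ → Vec (Fin n) n
    table g = tabulate (g ·_)

    lookup-table : ∀ (g : Automorphism Γ) i → lookup (table g) i ≡ g · i
    lookup-table g = lookup∘tabulate (g ·_)

    table-valid : ∀ g → Valid (table g) (table (g ⁻¹))
    table-valid g =
      (λ i → trans (lookup-table g _) (trans (cong (g ·_) (lookup-table (g ⁻¹) i))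
        (Permutation.inverseʳ (perm g)))) ,
      (λ i → trans (lookup-table (g ⁻¹) _) (trans (cong (g ⁻¹ ·_) (lookup-table g i))
        (Permutation.inverseˡ (perm g)))) ,
      (λ u v uv → subst₂ Adj (sym (lookup-table g u)) (sym (lookup-table g v))
        (Equivalence.to (adj⇔ g u v) uv)) ,
      (λ u v uv → Equivalence.from (adj⇔ g u v)
        (subst₂ Adj (lookup-table g u) (lookup-table g v) uv))

  -- Up to ≈ an automorphism is given by value tables of itself and of its inverse, so finitely many
  -- pairs of vectors are searched. As P respects ≈, the choice of validity proof for a pair is
  -- immaterial.
  ∃-automorphism? : ∀ (P : Carrier → Set) → (∀ {g h} → g ≈ h → P g → P h) →
                    (∀ g → Dec (P g)) → Dec (∃ P)
  ∃-automorphism? P P-resp P? =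
    map′ (λ (f , f′ , valid , p) → fromTables f f′ valid , p)
         (λ (g , p) → table g , table (g ⁻¹) , table-valid g ,
            P-resp {g} {fromTables (table g) (table (g ⁻¹)) (table-valid g)} (λ i → sym (lookup-table g i)) p)
         (any-vec? (λ f → ∃ (Realised f)) λ f → any-vec? (Realised f) (realised? f))
    where
    Realised : Vec (Fin n) n → Vec (Fin n) n → Set
    Realised f f′ = ∃ λ (valid : Valid f f′) → P (fromTables f f′ valid)
    realised? : ∀ f f′ → Dec (Realised f f′)
    realised? f f′ with Valid? f f′
    ... | no ¬valid = no (¬valid ∘ proj₁)
    ... | yes valid with P? (fromTables f f′ valid)
    ... | yes p = yes (valid , p)
    ... | no ¬p = no λ (valid′ , p) →
          ¬p (P-resp {fromTables f f′ valid′} {fromTables f f′ valid} (λ _ → refl) p)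

  vertexAction : Action (Aut Γ) (Fin n)
  vertexAction = record
    { _•_ = _·_ ; •-cong = λ g≈h → g≈h ; ε-• = λ _ → refl ; ∙-• = λ _ _ _ → refl }

  arcAction : Action (Aut Γ) (Fin n × Fin n)
  arcAction = record
    { _•_ = λ g (u , v) → g · u , g · v
    ; •-cong = λ g≈h (u , v) → cong₂ _,_ (g≈h u) (g≈h v)
    ; ε-• = λ _ → refl ; ∙-• = λ _ _ _ → refl }

  open Action vertexAction public using (•-injective; ⁻¹••; •⁻¹•; ⁻¹-fix)
  open Commuting (Aut Γ) using (_#_)

  adj-• : ∀ (g : Automorphism Γ) {u v} → Adj u v → Adj (g · u) (g · v)
  adj-• g {u} {v} = Equivalence.to (adj⇔ g u v)

  _≈?_ : ∀ g h → Dec (g ≈ h)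
  g ≈? h = all? λ i → (g · i) Fin.≟ (h · i)

  AbelianPair : Set
  AbelianPair = ∃₂ λ v w → v ≢ w × IsAbelian (PointwiseStabiliser Γ v w)

  adj⇒≢ : ∀ {u v} → Adj u v → u ≢ v
  adj⇒≢ uv refl = irreflexive uv

  connected-induction : Connected Γ → (T : Fin n → Set) → (∀ {u v} → Adj u v → T u → T v) →
                        ∀ {u} → T u → ∀ v → T v
  connected-induction (_ , path) T closed {u} Tu v = along (path u v) Tu
    where
    along : ∀ {u v} → Star Adj u v → T u → T v
    along stop Tu = Tu
    along (uw ◅ rest) Tu = along rest (closed uw Tu)

  module Neighbours (cubic : Cubic Γ) where

    ∈-neighbours⁺ : ∀ {v u} → Adj v u → u ∈ neighbours Γ v
    ∈-neighbours⁺ {v} {u} vu = lookup⇒[]= u _ (trans (lookup∘tabulate _ u) (dec-true (adj? v u) vu))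

    ∈-neighbours⁻ : ∀ {v u} → u ∈ neighbours Γ v → Adj v u
    ∈-neighbours⁻ {v} {u} u∈ with adj? v u | trans (sym (lookup∘tabulate _ u)) ([]=⇒lookup u∈)
    ... | yes vu | _ = vu
    ... | no _ | ()

    neighbour : ∀ v → ∃ λ u → Adj v u
    neighbour v with ∣∣≡suc⇒nonempty _ (cubic v)
    ... | u , u∈ = u , ∈-neighbours⁻ u∈

    second : ∀ {v u} → Adj v u → ∃ λ w → Adj v w × w ≢ u
    second {v} {u} vu with ∣∣≡suc⇒nonempty _
      (suc-injective (trans (sym (∣remove∣ (∈-neighbours⁺ vu))) (cubic v)))
    ... | w , w∈ with ∈-remove⁻ (neighbours Γ v) u w∈
    ... | w∈N , w≢u = w , ∈-neighbours⁻ w∈N , w≢u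

    third : ∀ {v t b} → Adj v t → Adj v b → b ≢ t →
            ∃ λ e → Adj v e × e ≢ t × e ≢ b × (∀ {d} → Adj v d → d ≢ t → d ≢ b → d ≡ e)
    third {v} {t} {b} vt vb b≢t = e , ∈-neighbours⁻ (proj₁ e∈N) , proj₂ e∈N , proj₂ e∈N′ , unique
      where
      N N′ N″ : Subset n
      N = neighbours Γ v
      N′ = N [ t ]≔ outside
      N″ = N′ [ b ]≔ outside
      b∈N′ : b ∈ N′
      b∈N′ = []≔-minimal N b t b≢t (∈-neighbours⁺ vb)
      ∣N″∣ : ∣ N″ ∣ ≡ 1
      ∣N″∣ = suc-injective (trans (sym (∣remove∣ b∈N′))
        (suc-injective (trans (sym (∣remove∣ (∈-neighbours⁺ vt))) (cubic v))))
      e : Fin n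
      e = proj₁ (∣∣≡suc⇒nonempty N″ ∣N″∣)
      e∈N″ : e ∈ N″
      e∈N″ = proj₂ (∣∣≡suc⇒nonempty N″ ∣N″∣)
      e∈N′ : e ∈ N′ × e ≢ b
      e∈N′ = ∈-remove⁻ N′ b e∈N″
      e∈N : e ∈ N × e ≢ t
      e∈N = ∈-remove⁻ N t (proj₁ e∈N′)
      unique : ∀ {d} → Adj v d → d ≢ t → d ≢ b → d ≡ e
      unique {d} vd d≢t d≢b = decidable-stable (d Fin.≟ e) λ d≢e →
        -- N″ has one element, so removing e leaves none; but a d other than e would remain.
        0≢1+n (trans
          (suc-injective (trans (sym ∣N″∣) (∣remove∣ e∈N″)))
          (∣remove∣ ([]≔-minimal N″ d e d≢e ([]≔-minimal N′ d b d≢b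
            ([]≔-minimal N d t d≢t (∈-neighbours⁺ vd))))))

    -- The form matches the at-most-two conditions of both digraphs: t is the neighbour excluded by
    -- the arc relation, b the one that d and e must avoid.
    at-most-three : ∀ {v t b d e} → Adj v t → Adj v b → Adj v d → Adj v e →
                    b ≢ t → d ≢ t → e ≢ t → d ≢ b → e ≢ b → d ≡ e
    at-most-three vt vb vd ve b≢t d≢t e≢t d≢b e≢b with third vt vb b≢t
    ... | _ , _ , _ , _ , unique = trans (unique vd d≢t d≢b) (sym (unique ve e≢t e≢b))

  module VertexTransitiveCubic (connected : Connected Γ) (vt : VertexTransitive Γ) (cubic : Cubic Γ) where
    open Neighbours cubic

    FixesNeighbour : Fin n → Fin n → Set
    FixesNeighbour v u = Adj v u × (∀ (g : Automorphism Γ) → g · v ≡ v → g · u ≡ u)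

    moved? : ∀ v u → (∃ λ (g : Automorphism Γ) → g · v ≡ v × g · u ≢ u) ⊎
                     (∀ (g : Automorphism Γ) → g · v ≡ v → g · u ≡ u)
    moved? v u with ∃-automorphism? (λ g → g · v ≡ v × g · u ≢ u)
      (λ {g} {h} g≈h (gv , gu) → trans (sym (g≈h v)) gv , λ hu → gu (trans (g≈h u) hu))
      (λ g → ((g · v) Fin.≟ v) ×-dec ¬? ((g · u) Fin.≟ u))
    ... | yes moved = inj₁ moved
    ... | no ¬moved = inj₂ λ g gv → decidable-stable ((g · u) Fin.≟ u) λ gu → ¬moved (g , gv , gu)

    fixesNeighbour? : ∀ v u → Dec (FixesNeighbour v u)
    fixesNeighbour? v u with adj? v u | moved? v u
    ... | no ¬vu | _ = no (¬vu ∘ proj₁)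
    ... | yes _ | inj₁ (g , gv , gu) = no λ (_ , f) → gu (f g gv)
    ... | yes vu | inj₂ f = yes (vu , f)

    pair : ∀ {v w} → v ≢ w →
           (∀ (g h : Automorphism Γ) → g · v ≡ v → g · w ≡ w → h · v ≡ v → h · w ≡ w → g # h) → AbelianPair
    pair v≢w commute = _ , _ , v≢w , λ (g , gv , gw) (h , hv , hw) → commute g h gv gw hv hw

    -- Stabilisers moving all neighbours: the digraph of arcs

    Arc : Fin n × Fin n → Set
    Arc (u , v) = Adj u v

    Follows : Fin n × Fin n → Fin n × Fin n → Set
    Follows (u , v) (v′ , w) = v ≡ v′ × Adj u v × Adj v w × u ≢ w

    module ArcTransitive (v₀ : Fin n)
      (local : ∀ {u} → Adj v₀ u → ∃ λ (g : Automorphism Γ) → g · v₀ ≡ v₀ × g · u ≢ u) where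
      open Action arcAction using () renaming (_•_ to _•ₐ_)

      -- A group without fixed points on a set of size three is transitive on it.
      locally-transitive : ∀ {u w} → Adj v₀ u → Adj v₀ w → ∃ λ g → g · v₀ ≡ v₀ × g · u ≡ w
      locally-transitive {u} {w} vu vw with u Fin.≟ w
      ... | yes refl = idᴬ , refl , refl
      ... | no u≢w with local vu | local vw
      ... | g , gv , gu≢u | h , hv , hw≢w with (g · u) Fin.≟ w | (h · w) Fin.≟ u
      ... | yes gu≡w | _ = g , gv , gu≡w
      ... | no _ | yes hw≡u = h ⁻¹ , ⁻¹-fix {h} hv , trans (cong (h ⁻¹ ·_) (sym hw≡u)) (⁻¹•• h w)
      ... | no gu≢w | no hw≢u = h ⁻¹ ∙ g , trans (cong (h ⁻¹ ·_) gv) (⁻¹-fix {h} hv) ,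
        trans (cong (h ⁻¹ ·_) (at-most-three vu vw (move g gv vu) (move h hv vw)
                                (u≢w ∘ sym) gu≢u hw≢u gu≢w hw≢w))
              (⁻¹•• h w)
        where
        move : ∀ g {u} → g · v₀ ≡ v₀ → Adj v₀ u → Adj v₀ (g · u)
        move g {u} gv vu = subst (λ t → Adj t (g · u)) gv (adj-• g vu)

      arc-transitive : ∀ {x y} → Arc x → Arc y → ∃ λ g → g •ₐ x ≡ y
      arc-transitive {u , v} {u′ , v′} uv u′v′ with vt u v₀ | vt u′ v₀
      ... | h , hu | h′ , hu′ with locally-transitive
              (subst (λ t → Adj t (h · v)) hu (adj-• h uv))
              (subst (λ t → Adj t (h′ · v′)) hu′ (adj-• h′ u′v′))
      ... | g , gv₀ , ghv = h′ ⁻¹ ∙ (g ∙ h) , cong₂ _,_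
              (trans (cong (h′ ⁻¹ ·_) (trans (trans (cong (g ·_) hu) gv₀) (sym hu′))) (⁻¹•• h′ u′))
              (trans (cong (h′ ⁻¹ ·_) ghv) (⁻¹•• h′ v′))

      faithful : ∀ g (P : Fin n × Fin n → Set) → (∀ {x y} → Follows x y → P x → P y) →
                 (∀ {x y} → Follows x y → P y → P x) → (∀ {x} → P x → g •ₐ x ≡ x) →
                 ∀ {x} → Arc x → P x → g ≈ idᴬ
      faithful g P forward backward fixed {u₀ , w₀} uw₀ Puw₀ v =
        let (_ , _ , Puv) = connected-induction connected T closed (u₀ , uw₀ , Puw₀) v
        in cong proj₂ (fixed Puv)
        where
        T : Fin n → Set
        T v = ∃ λ u → Adj u v × P (u , v)
        closed : ∀ {v w} → Adj v w → T v → T w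
        closed {v} {w} vw (u , uv , Puv) with u Fin.≟ w
        ... | no u≢w = v , vw , forward (refl , uv , vw , u≢w) Puv
        -- The arc (v , u) does not follow (u , v). It is reached by going forward to (v , w₂),
        -- backward to (w₁ , v) and forward to (v , u).
        ... | yes refl with second vw
        ... | w₁ , vw₁ , w₁≢u with third vw vw₁ w₁≢u
        ... | w₂ , vw₂ , w₂≢u , w₂≢w₁ , _ = v , vw ,
              forward (refl , symmetric vw₁ , vw , w₁≢u)
                (backward (refl , symmetric vw₁ , vw₂ , w₂≢w₁ ∘ sym)
                  (forward (refl , uv , vw₂ , w₂≢u ∘ sym) Puv))

      digraph : IsTransitiveDigraph arcAction Arc Follows
      digraph = record
        { size = n * n
        ; code = uncurry combine
        ; code-injective = λ { {a , b} {c , d} eq → ×-≡,≡→≡ (combine-injective a b c d eq) }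
        ; source = λ { (_ , uv , _) → uv }
        ; target = λ { (refl , _ , vw , _) → vw }
        ; E-• = λ { g (refl , uv , vw , u≢w) →
                    refl , adj-• g uv , adj-• g vw , u≢w ∘ •-injective g }
        ; out≤2 = λ { (refl , uv , vw , u≢w) (refl , _ , vw₁ , u≢w₁) (refl , _ , vw₂ , u≢w₂) w₁≢w w₂≢w →
            cong (_ ,_) (at-most-three (symmetric uv) vw vw₁ vw₂ (u≢w ∘ sym) (u≢w₁ ∘ sym) (u≢w₂ ∘ sym)
              (w₁≢w ∘ cong (_ ,_)) (w₂≢w ∘ cong (_ ,_))) }
        ; in≤2 = λ { (refl , uv , vw , u≢w) (refl , u₁v , _ , u₁≢w) (refl , u₂v , _ , u₂≢w) u₁≢u u₂≢u →
            cong (_, _) (at-most-three vw (symmetric uv) (symmetric u₁v) (symmetric u₂v) u≢w u₁≢w u₂≢w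
              (u₁≢u ∘ cong (_, _)) (u₂≢u ∘ cong (_, _))) }
        ; transitive = arc-transitive
        ; faithful = faithful
        ; _≈?_ = _≈?_
        ; ∃? = ∃-automorphism?
        }

      first-arcs : ∃₂ λ x y → Follows x y
      first-arcs with neighbour v₀
      ... | u , vu with second (symmetric vu)
      ... | w , uw , w≢v = (v₀ , u) , (u , w) , refl , vu , uw , w≢v ∘ sym

    -- Non-backtracking walks and segments of arcs

    module ArcSegments (digraph : IsTransitiveDigraph arcAction Arc Follows)
                       {x₀ x₁ : Fin n × Fin n} (x₀→x₁ : Follows x₀ x₁) where
      open Action arcAction using () renaming (_•_ to _•ₐ_)
      open Digraph digraph x₀→x₁
      open Segments arcAction α

      p : ℕ → Fin n
      p i = proj₁ (α i)

      α₂ : ∀ i → proj₂ (α i) ≡ p (suc i)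
      α₂ i = proj₁ (α-E i)

      -- Some g fixes α 0, ..., α k and moves α (k+1), so it fixes p 0 and moves the head of α
      -- (k+1).
      no-return : ∀ k → k < s → p 0 ≢ proj₂ (α (suc k))
      no-return k k<s eq with moves k k<s
      ... | g , f , m = m (cong₂ _,_
              (subst (λ t → g · t ≡ t) (α₂ k) (cong proj₂ (fixed f k z≤n ≤-refl)))
              (subst (λ t → g · t ≡ t) eq (cong proj₁ (fixed f 0 z≤n z≤n))))

      NonBacktracking : ℕ → Fin n × Fin n → Fin n × Fin n → Set
      NonBacktracking = Walk (λ _ → ⊤)

      -- Some automorphism carries the ends of an initial segment of α to those of the walk, so
      -- `no-return` applies. As k + 1 steps between arcs traverse k + 2 edges, closed walks with 2,
      -- ..., s + 1 edges are excluded.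
      not-closed : ∀ {k x y} → suc k ≤ s → Arc x → NonBacktracking (suc k) x y → proj₁ x ≢ proj₂ y
      not-closed {k} {x} {y} k<s Vx walk eq with walk-transitive k<s Vx walk
      ... | g , g0 , gk , _ = no-return k k<s (•-injective g
              (trans (cong proj₁ g0) (trans eq (sym (cong proj₂ gk)))))

      follow : ∀ g {x i} b k → NonBacktracking i x (g •ₐ α b) → NonBacktracking (k + i) x (g •ₐ α (k + b))
      follow g b zero walk = walk
      follow g b (suc k) walk = step (follow g b k walk) (IsTransitiveDigraph.E-• digraph g (α-E (k + b))) tt

      retrace : ∀ b k → NonBacktracking k (swap (α (k + b))) (swap (α b))
      retrace b k = go k b refl
        where
        go : ∀ i b {m} → i + b ≡ m → NonBacktracking i (swap (α m)) (swap (α b))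
        go zero b refl = start tt
        go (suc i) b eq with go i (suc b) (trans (+-suc i b) eq) | α-E b
        ... | walk | e , xy , yz , x≢z = step walk (sym e , symmetric yz′ ,
            subst (λ t → Adj t (proj₁ (α b))) e (symmetric xy) , x≢z ∘ sym) tt
          where
          yz′ : Adj (proj₁ (α (suc b))) (proj₂ (α (suc b)))
          yz′ = subst (λ t → Adj t (proj₂ (α (suc b)))) e yz

      α-Arc : ∀ i → Arc (α i)
      α-Arc i = IsTransitiveDigraph.source digraph (α-E i)

      -- A second path between the two ends would close up to a non-backtracking walk of
      -- length at most s + 1.
      between : ∀ (g : Automorphism Γ) l b → l + l ≤ suc s → g · p b ≡ p b → g · p (l + b) ≡ p (l + b) →
                ∀ i → i ≤ l → g · p (i + b) ≡ p (i + b)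
      between g l b _ gb gl zero _ = gb
      between g (suc l) b le gb gl (suc i) (s≤s i≤l) with (g · p (suc b)) Fin.≟ p (suc b)
      ... | yes gsb = subst (λ t → g · p t ≡ p t) (+-suc i b)
              (between g l (suc b) (≤-trans (+-mono-≤ (n≤1+n l) (n≤1+n l)) le) gsb
                (subst (λ t → g · p t ≡ p t) (sym (+-suc l b)) gl) i i≤l)
      -- The walk runs back from p (l+1+b) to p b and then along the image under g to g (p (l+1+b)).
      -- It does not backtrack at p b because g moves p (b+1).
      ... | no gsb = ⊥-elim (not-closed 2l<s (symmetric (α-Arc (l + b)))
              (subst (λ k → NonBacktracking k (swap (α (l + b))) (g •ₐ α (l + b))) (+-suc l l)
                (follow g b l (step (retrace b l) turn tt)))
              (trans (α₂ (l + b)) (trans (sym gl) (cong (g ·_) (sym (α₂ (l + b)))))))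
        where
        2l<s : suc (l + l) ≤ s
        2l<s = ≤-pred (subst (_≤ suc s) (cong suc (+-suc l l)) le)
        turn : Follows (swap (α b)) (g •ₐ α b)
        turn = sym gb , symmetric (α-Arc b) , subst (λ t → Adj t (g · proj₂ (α b))) gb (adj-• g (α-Arc b)) ,
          λ eq → gsb (trans (cong (g ·_) (sym (α₂ b))) (trans (sym eq) (α₂ b)))

      abelianPair : AbelianPair
      abelianPair with abelian-stabiliser-or-segment
      ... | inj₁ ((u , v) , uv , commute) = pair (adj⇒≢ uv) λ g h gu gv hu hv →
              commute g h (cong₂ _,_ gu gv) (cong₂ _,_ hu hv)
      -- With J = `suc j`, the arcs α s, ..., α (s+J) lead from p s to p (s+J+1), and 2J + 1 ≤ s
      -- becomes 2(J+1) ≤ s + 1, the bound in `between`.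
      ... | inj₂ (suc j , _ , 2j<s , _ , commute , _) = pair {p s} {p (suc (suc j) + s)} distinct
              (λ g h gs gt hs ht → commute g h (segment g gs gt) (segment h hs ht))
        where
        distinct : p s ≢ p (suc (suc j) + s)
        distinct eq = not-closed (≤-trans (m≤m+n (suc j) (suc j)) (≤-trans (n≤1+n _) 2j<s)) (α-Arc s)
          (subst (λ k → NonBacktracking k (α s) (α (suc j + s))) (+-identityʳ (suc j))
            (follow idᴬ s (suc j) (start tt)))
          (trans eq (sym (α₂ (suc j + s))))
        segment : ∀ (g : Automorphism Γ) → g · p s ≡ p s →
                  g · p (suc (suc j) + s) ≡ p (suc (suc j) + s) → Fix g s (s + suc j)
        segment g gs gt .fixed i s≤i i≤s+j =
          cong₂ _,_ (at i s≤i (≤-trans i≤s+j (n≤1+n _)))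
            (subst (λ t → g · t ≡ t) (sym (α₂ i)) (at (suc i) (≤-trans s≤i (n≤1+n i)) (s≤s i≤s+j)))
          where
          at : ∀ i → s ≤ i → i ≤ suc (s + suc j) → g · p i ≡ p i
          at i s≤i i≤ = subst (λ t → g · p t ≡ p t) (m∸n+n≡m s≤i)
            (between g (suc (suc j)) s
              (subst (_≤ suc s) (cong suc (sym (+-suc (suc j) (suc j)))) (s≤s 2j<s))
              gs gt (i ∸ s) (m≤n+o⇒m∸n≤o i s (≤-trans i≤ (≤-reflexive (sym (+-suc s (suc j)))))))

    -- Stabilisers fixing exactly one neighbour: mates

    -- Because of ĝ, u₀ is the only neighbour of v₀ fixed by the stabiliser of v₀.
    module FixedNeighbour (v₀ u₀ : Fin n) (v₀u₀ : FixesNeighbour v₀ u₀)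
      (ĝ : Automorphism Γ) (ĝv₀ : ĝ · v₀ ≡ v₀) (w₀ : Fin n) (v₀w₀ : Adj v₀ w₀) (ĝw₀ : ĝ · w₀ ≢ w₀) where

      private
        carry : Fin n → Automorphism Γ
        carry x = proj₁ (vt v₀ x)

        carry-v₀ : ∀ x → carry x · v₀ ≡ x
        carry-v₀ x = proj₂ (vt v₀ x)

      mate : Fin n → Fin n
      mate x = carry x · u₀

      -- Two elements carrying v₀ to x differ by one that fixes v₀ and hence u₀, so `mate` is
      -- independent of the choice of `carry`.
      mate-unfold : ∀ h {x} → h · v₀ ≡ x → h · u₀ ≡ mate x
      mate-unfold h {x} hv₀ = trans (sym (•⁻¹• (carry x) (h · u₀)))
        (cong (carry x ·_) (proj₂ v₀u₀ (carry x ⁻¹ ∙ h)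
          (trans (cong (carry x ⁻¹ ·_) (trans hv₀ (sym (carry-v₀ x)))) (⁻¹•• (carry x) v₀))))

      mate-• : ∀ g x → g · mate x ≡ mate (g · x)
      mate-• g x = mate-unfold (g ∙ carry x) (cong (g ·_) (carry-v₀ x))

      mate-fixed : ∀ g {x} → g · x ≡ x → g · mate x ≡ mate x
      mate-fixed g {x} gx = trans (mate-• g x) (cong mate gx)

      adj-mate : ∀ x → Adj x (mate x)
      adj-mate x = subst (λ t → Adj t (mate x)) (carry-v₀ x) (adj-• (carry x) (proj₁ v₀u₀))

      -- Transported to v₀, t becomes a neighbour t′ fixed by ĝ. If t′ ≠ u₀, the neighbours of v₀
      -- are u₀, w₀, t′, and ĝ w₀ can only be t′ = ĝ t′, against injectivity.
      fixed⇒mate : ∀ {x t} → FixesNeighbour x t → t ≡ mate x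
      fixed⇒mate {x} {t} (xt , fixes-t) = trans (sym (•⁻¹• h t)) (cong (h ·_) t′≡u₀)
        where
        h : Automorphism Γ
        h = carry x
        h⁻¹x : h ⁻¹ · x ≡ v₀
        h⁻¹x = trans (cong (h ⁻¹ ·_) (sym (carry-v₀ x))) (⁻¹•• h v₀)
        t′ : Fin n
        t′ = h ⁻¹ · t
        v₀t′ : Adj v₀ t′
        v₀t′ = subst (λ y → Adj y t′) h⁻¹x (adj-• (h ⁻¹) xt)
        ĝt′ : ĝ · t′ ≡ t′
        ĝt′ = trans (sym (⁻¹•• h (ĝ · t′))) (cong (h ⁻¹ ·_) (fixes-t (h ∙ (ĝ ∙ h ⁻¹)) fixes-x))
          where
          fixes-x : h · (ĝ · (h ⁻¹ · x)) ≡ x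
          fixes-x = trans (cong (h ·_) (trans (cong (ĝ ·_) h⁻¹x) (trans ĝv₀ (sym h⁻¹x)))) (•⁻¹• h x)
        ĝu₀ : ĝ · u₀ ≡ u₀
        ĝu₀ = proj₂ v₀u₀ ĝ ĝv₀
        t′≡u₀ : t′ ≡ u₀
        t′≡u₀ = decidable-stable (t′ Fin.≟ u₀) λ t′≢u₀ → t′≢w₀ (•-injective ĝ
            (trans ĝt′ (at-most-three (proj₁ v₀u₀) v₀w₀ v₀t′
              (subst (λ t → Adj t (ĝ · w₀)) ĝv₀ (adj-• ĝ v₀w₀))
              w₀≢u₀ t′≢u₀ (λ e → w₀≢u₀ (•-injective ĝ (trans e (sym ĝu₀)))) t′≢w₀ ĝw₀)))
          where
          w₀≢u₀ : w₀ ≢ u₀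
          w₀≢u₀ refl = ĝw₀ ĝu₀
          t′≢w₀ : t′ ≢ w₀
          t′≢w₀ e = ĝw₀ (subst (λ t → ĝ · t ≡ t) e ĝt′)

      -- Iterating `mate` from v₀ runs through the periodic orbit of v₀ under h. What fixes u₀
      -- therefore fixes all later points, v₀ among them, so v₀ is the fixed neighbour of u₀.
      mate-u₀ : mate u₀ ≡ v₀
      mate-u₀ = sym (fixed⇒mate (symmetric (proj₁ v₀u₀) , stabiliser-u₀))
        where
        open Orbits vertexAction (λ x → x) (λ e → e)
        h : Automorphism Γ
        h = carry u₀
        mate-orbit : ∀ i → mate (orbit h v₀ i) ≡ orbit h v₀ (suc i)
        mate-orbit zero = trans (sym (mate-unfold idᴬ refl)) (sym (carry-v₀ u₀))
        mate-orbit (suc i) = trans (sym (mate-• h (orbit h v₀ i))) (cong (h ·_) (mate-orbit i))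
        stabiliser-u₀ : ∀ g → g · u₀ ≡ u₀ → g · v₀ ≡ v₀
        stabiliser-u₀ g gu₀ with periodic h v₀
        ... | N , eq = subst (λ x → g · x ≡ x) eq (along N)
          where
          along : ∀ i → g · orbit h v₀ (suc i) ≡ orbit h v₀ (suc i)
          along zero = subst (λ x → g · x ≡ x) (sym (carry-v₀ u₀)) gu₀
          along (suc i) = subst (λ x → g · x ≡ x) (mate-orbit (suc i)) (mate-fixed g (along i))

      mate-involutive : ∀ x → mate (mate x) ≡ x
      mate-involutive x = trans (sym (mate-• (carry x) u₀)) (trans (cong (carry x ·_) mate-u₀) (carry-v₀ x))

      mate-injective : ∀ {x y} → mate x ≡ mate y → x ≡ y
      mate-injective {x} {y} e = trans (sym (mate-involutive x)) (trans (cong mate e) (mate-involutive y))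

      Next : Fin n → Fin n → Set
      Next x y = Adj (mate x) y × y ≢ x

      -- What fixes mate x fixes x, so it suffices that x or mate x lies in P, and this property
      -- passes along every edge of Γ.
      faithful : ∀ g (P : Fin n → Set) → (∀ {x y} → Next x y → P x → P y) →
                 (∀ {x y} → Next x y → P y → P x) → (∀ {x} → P x → g · x ≡ x) →
                 ∀ {x} → ⊤ → P x → g ≈ idᴬ
      faithful g P forward backward fixed {x} _ Px = λ y →
        fixes (connected-induction connected T closed {x} (inj₁ Px) y)
        where
        T : Fin n → Set
        T x = P x ⊎ P (mate x)
        fixes : ∀ {x} → T x → g · x ≡ x
        fixes (inj₁ Px) = fixed Px
        fixes {x} (inj₂ Pmx) = subst (λ t → g · t ≡ t) (mate-involutive x) (mate-fixed g (fixed Pmx))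
        closed : ∀ {x w} → Adj x w → T x → T w
        closed {x} {w} xw (inj₁ Px) with x Fin.≟ mate w
        ... | yes refl = inj₂ Px
        ... | no x≢mw = inj₂ (backward
                (subst (λ t → Adj t x) (sym (mate-involutive w)) (symmetric xw) , x≢mw) Px)
        closed {x} {w} xw (inj₂ Pmx) with w Fin.≟ mate x
        ... | yes refl = inj₁ Pmx
        ... | no w≢mx = inj₁ (forward (subst (λ t → Adj t w) (sym (mate-involutive x)) xw , w≢mx) Pmx)

      digraph : IsTransitiveDigraph vertexAction (λ _ → ⊤) Next
      digraph = record
        { size = n
        ; code = λ x → x
        ; code-injective = λ e → e
        ; source = λ _ → tt
        ; target = λ _ → tt
        ; E-• = λ g {x} {y} (xy , y≢x) → subst (λ t → Adj t (g · y)) (mate-• g x) (adj-• g xy) ,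
                                  y≢x ∘ •-injective g
        ; out≤2 = λ {x} (xy , y≢x) (xy₁ , y₁≢x) (xy₂ , y₂≢x) y₁≢y y₂≢y →
            at-most-three (symmetric (adj-mate x)) xy xy₁ xy₂ y≢x y₁≢x y₂≢x y₁≢y y₂≢y
        ; in≤2 = λ {x} (yx , x≢y) (y₁x , x≢y₁) (y₂x , x≢y₂) y₁≢y y₂≢y → mate-injective
            (at-most-three (adj-mate x) (symmetric yx) (symmetric y₁x) (symmetric y₂x)
              (x≢y ∘ sym ∘ mate-injective) (x≢y₁ ∘ sym ∘ mate-injective) (x≢y₂ ∘ sym ∘ mate-injective)
              (y₁≢y ∘ mate-injective) (y₂≢y ∘ mate-injective))
        ; transitive = λ {x} {y} _ _ → vt x y
        ; faithful = faithful
        ; _≈?_ = _≈?_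
        ; ∃? = ∃-automorphism?
        }

      first-edge : ∃ (Next v₀)
      first-edge with second (symmetric (adj-mate v₀))
      ... | w , uw , w≢v₀ = w , uw , w≢v₀

      open Digraph using (abelian-stabiliser-or-segment)

      abelianPair : AbelianPair
      abelianPair with abelian-stabiliser-or-segment digraph (proj₂ first-edge)
      ... | inj₁ (x , _ , commute) = pair (adj⇒≢ (adj-mate x)) λ g h gx _ hx _ → commute g h gx hx
      ... | inj₂ (j , _ , _ , distinct , commute , between) = pair distinct λ g h gs gt hs ht →
              commute g h (between g gs gt) (between h hs ht)

    -- Trivial stabilisers and the case distinction

    -- By vertex-transitivity the hypothesis holds at every vertex, so fixed points of g spread
    -- along edges.
    trivial-stabiliser : ∀ v → (∀ g → g · v ≡ v → ∀ u → Adj v u → g · u ≡ u) →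
                         ∀ g → g · v ≡ v → ∀ x → g · x ≡ x
    trivial-stabiliser v fixes-neighbours g gv = connected-induction connected (λ x → g · x ≡ x) closed gv
      where
      closed : ∀ {x y} → Adj x y → g · x ≡ x → g · y ≡ y
      closed {x} {y} xy gx with vt v x
      ... | h , refl = trans (sym (•⁻¹• h (g · y)))
        (trans (cong (h ·_) (trans (cong (λ t → h ⁻¹ · (g · t)) (sym (•⁻¹• h y)))
          (fixes-neighbours (h ⁻¹ ∙ (g ∙ h)) (trans (cong (h ⁻¹ ·_) gx) (⁻¹•• h v)) (h ⁻¹ · y)
            (subst (λ t → Adj t (h ⁻¹ · y)) (⁻¹•• h v) (adj-• (h ⁻¹) xy)))))
          (•⁻¹• h y))

    abelianPair : AbelianPair
    abelianPair with proj₁ connected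
    ... | v with any? (fixesNeighbour? v)
    ... | no none = ArcSegments.abelianPair (ArcTransitive.digraph v local)
            (proj₂ (proj₂ (ArcTransitive.first-arcs v local)))
      where
      local : ∀ {u} → Adj v u → ∃ λ g → g · v ≡ v × g · u ≢ u
      local {u} vu with moved? v u
      ... | inj₁ moved = moved
      ... | inj₂ f = ⊥-elim (none (u , vu , f))
    ... | yes (u , vu) with any? {P = λ w → Adj v w × ∃ λ g → g · v ≡ v × g · w ≢ w} moves?
      where
      moves? : ∀ w → Dec (Adj v w × ∃ λ g → g · v ≡ v × g · w ≢ w)
      moves? w with moved? v w
      ... | inj₁ m = map′ (_, m) proj₁ (adj? v w)
      ... | inj₂ f = no λ (_ , g , gv , gw) → gw (f g gv)
    ... | yes (w , vw , g , gv , gw) = FixedNeighbour.abelianPair v u vu g gv w vw gw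
    ... | no none = pair (adj⇒≢ (proj₁ vu)) λ g h gv _ hv _ x →
            trans (trans (cong (g ·_) (trivial h hv x)) (trivial g gv x))
              (sym (trans (cong (h ·_) (trivial g gv x)) (trivial h hv x)))
      where
      trivial : ∀ g → g · v ≡ v → ∀ x → g · x ≡ x
      trivial = trivial-stabiliser v λ g gv w vw →
        decidable-stable ((g · w) Fin.≟ w) λ gw → none (w , vw , g , gv , gw)

corollary1p3 : ∀ (n : ℕ) (Γ : Graph n) → Connected Γ → VertexTransitive Γ → Cubic Γ →
    ∃₂ λ v w → v ≢ w × IsAbelian (PointwiseStabiliser Γ v w)
corollary1p3 n Γ = VertexTransitiveCubic.abelianPair Γ
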